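{- Let $\mathcal{C}$ be a topos. Then the power-object assignment $X\mapsto\mathcal{P}X$ extends to a commutative (strong) monad on $\mathcal{C}$ whose Kleisli category is isomorphic to the category of relations $\mathbf{Rel}(\mathcal{C})$.
   Context: A topos is a finitely complete category with power-objects: for every object $X$ there are an object $\mathcal{P}X$ and a mono $\in_X:E_X\rightarrowtail X\times\mathcal{P}X$ such that for every mono $m:R\rightarrowtail X\times Y$ there is a unique morphism $\xi_m:Y\to\mathcal{P}X$ such that $m$ is a pullback of $\in_X$ along $\mathrm{id}_X\times\xi_m:X\times Y\to X\times\mathcal{P}X$. The morphism $\xi_m$ depends only on the subobject $r$ represented by $m$, and is also written $\xi_r$. $\mathbf{Rel}(\mathcal{C})$ is the category with the objects of $\mathcal{C}$, whose morphisms from $X$ to $Y$ are the relations from $X$ to $Y$, i.e. subobjects of $X\times Y$. The composite $r;s$ of $r$ (represented by $m_r:R\rightarrowtail X\times Y$) and $s$ (represented by $m_s:S\rightarrowtail Y\times Z$) is represented by the mono part of the (epi, mono)-factorisation of $\langle \pi_1\cdot m_r\cdot\mu_1,\pi_2\cdot m_s\cdot\mu_2\rangle:R\star S\to X\times Z$, where $(R\star S,\mu_1,\mu_2)$ is the pullback of $\pi_2\cdot m_r$ and $\pi_1\cdot m_s$ over $Y$. The identity on $X$ is the diagonal $\Delta_X$, represented by $\langle\mathrm{id},\mathrm{id}\rangle:X\rightarrowtail X\times X$. The (covariant) monad structure is as follows. For $f:X\to Y$, $\mathcal{P}f=\xi_{m_f}:\mathcal{P}X\to\mathcal{P}Y$,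 where $m_f:E_f\rightarrowtail Y\times\mathcal{P}X$ is the mono part of the (epi, mono)-factorisation of $(f\times\mathrm{id})\cdot\in_X:E_X\to Y\times\mathcal{P}X$. The unit is $\eta_X=\xi_{\Delta_X}:X\to\mathcal{P}X$. The multiplication is $\mu_X=\xi_{(\in_X;\in_{\mathcal{P}X})}:\mathcal{P}\mathcal{P}X\to\mathcal{P}X$, where $\in_X$ is viewed as a relation from $X$ to $\mathcal{P}X$ and $\in_{\mathcal{P}X}$ as a relation from $\mathcal{P}X$ to $\mathcal{P}\mathcal{P}X$. The strength $t_{X,Y}:X\times\mathcal{P}Y\to\mathcal{P}(X\times Y)$ is $\xi_m$, where $m$ is the mono part of the (epi, mono)-factorisation of $\langle \mathrm{id}_X\times\pi_1,\mathrm{id}_X\times\pi_2\rangle\cdot(\mathrm{id}_X\times\in_Y):X\times E_Y\to(X\times Y)\times(X\times\mathcal{P}Y)$. -}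

module Defs where

open import Level using (Level; _⊔_; suc)
open import Data.Product using (Σ-syntax; _,_; proj₁; proj₂) renaming (_×_ to _∧_)
open import Function using (flip) renaming (_∘_ to _·_; id to idᶠ)
open import Relation.Binary using (IsEquivalence; Setoid)
open import Relation.Binary.PropositionalEquality using (_≡_; subst₂)
import Relation.Binary.Reasoning.Setoid as SetoidReasoning

-- Hom-types carry an explicit equality, as usual without quotients.
record Category (o ℓ e : Level) : Set (suc (o ⊔ ℓ ⊔ e)) where
  infix  4 _≈_ _⇒_
  infixr 9 _∘_
  field
    Obj : Set o
    _⇒_ : Obj → Obj → Set ℓ
    _≈_ : ∀ {A B} → A ⇒ B → A ⇒ B → Set e
    id  : ∀ {A} → A ⇒ A
    _∘_ : ∀ {A B C} → B ⇒ C → A ⇒ B → A ⇒ C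
    equiv     : ∀ {A B} → IsEquivalence (_≈_ {A} {B})
    ∘-resp-≈  : ∀ {A B C} {f h : B ⇒ C} {g i : A ⇒ B} → f ≈ h → g ≈ i → f ∘ g ≈ h ∘ i
    assoc     : ∀ {A B C D} {f : A ⇒ B} {g : B ⇒ C} {h : C ⇒ D} → (h ∘ g) ∘ f ≈ h ∘ (g ∘ f)
    identityˡ : ∀ {A B} {f : A ⇒ B} → id ∘ f ≈ f
    identityʳ : ∀ {A B} {f : A ⇒ B} → f ∘ id ≈ f

  hom-setoid : Obj → Obj → Setoid ℓ e
  hom-setoid A B = record { Carrier = A ⇒ B ; _≈_ = _≈_ ; isEquivalence = equiv }

  module _ {A B : Obj} where
    open IsEquivalence (equiv {A} {B}) public
      renaming (refl to ≈-refl; sym to ≈-sym; trans to ≈-trans) using ()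
    open SetoidReasoning (hom-setoid A B) public

  ∘-resp-≈ˡ : ∀ {A B C} {f h : B ⇒ C} {g : A ⇒ B} → f ≈ h → f ∘ g ≈ h ∘ g
  ∘-resp-≈ˡ p = ∘-resp-≈ p ≈-refl

  ∘-resp-≈ʳ : ∀ {A B C} {f : B ⇒ C} {g i : A ⇒ B} → g ≈ i → f ∘ g ≈ f ∘ i
  ∘-resp-≈ʳ p = ∘-resp-≈ ≈-refl p

  pullˡ : ∀ {A B C D} {f : A ⇒ B} {g : B ⇒ C} {h : C ⇒ D} {k : B ⇒ D} →
          h ∘ g ≈ k → h ∘ (g ∘ f) ≈ k ∘ f
  pullˡ p = ≈-trans (≈-sym assoc) (∘-resp-≈ˡ p)

  pullʳ : ∀ {A B C D} {f : A ⇒ B} {g : B ⇒ C} {h : C ⇒ D} {k : A ⇒ C} →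
          g ∘ f ≈ k → (h ∘ g) ∘ f ≈ h ∘ k
  pullʳ p = ≈-trans assoc (∘-resp-≈ʳ p)

  Mono : ∀ {A B} → A ⇒ B → Set (o ⊔ ℓ ⊔ e)
  Mono {A} m = ∀ {Z} (g h : Z ⇒ A) → m ∘ g ≈ m ∘ h → g ≈ h

  Epi : ∀ {A B} → A ⇒ B → Set (o ⊔ ℓ ⊔ e)
  Epi {B = B} q = ∀ {Z} (g h : B ⇒ Z) → g ∘ q ≈ h ∘ q → g ≈ h

  record IsPullback {A B D Q} (p : Q ⇒ A) (q : Q ⇒ B) (f : A ⇒ D) (g : B ⇒ D)
         : Set (o ⊔ ℓ ⊔ e) where
    field
      commute   : f ∘ p ≈ g ∘ q
      universal : ∀ {Z} {h : Z ⇒ A} {k : Z ⇒ B} → f ∘ h ≈ g ∘ k → Z ⇒ Q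
      p∘universal : ∀ {Z} {h : Z ⇒ A} {k : Z ⇒ B} (c : f ∘ h ≈ g ∘ k) → p ∘ universal c ≈ h
      q∘universal : ∀ {Z} {h : Z ⇒ A} {k : Z ⇒ B} (c : f ∘ h ≈ g ∘ k) → q ∘ universal c ≈ k
      unique    : ∀ {Z} {u v : Z ⇒ Q} → p ∘ u ≈ p ∘ v → q ∘ u ≈ q ∘ v → u ≈ v

  record EpiMonoFactorisation {A B} (f : A ⇒ B) : Set (o ⊔ ℓ ⊔ e) where
    field
      {image}   : Obj
      epiPart   : A ⇒ image
      monoPart  : image ⇒ B
      epi       : Epi epiPart
      mono      : Mono monoPart
      factors   : monoPart ∘ epiPart ≈ f

record Functor {o ℓ e o′ ℓ′ e′} (𝒞 : Category o ℓ e) (𝒟 : Category o′ ℓ′ e′)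
       : Set (o ⊔ ℓ ⊔ e ⊔ o′ ⊔ ℓ′ ⊔ e′) where
  private
    module C = Category 𝒞
    module D = Category 𝒟
  field
    F₀ : C.Obj → D.Obj
    F₁ : ∀ {A B} → A C.⇒ B → F₀ A D.⇒ F₀ B
    F-resp-≈     : ∀ {A B} {f g : A C.⇒ B} → f C.≈ g → F₁ f D.≈ F₁ g
    identity     : ∀ {A} → F₁ (C.id {A}) D.≈ D.id
    homomorphism : ∀ {A B C} {f : A C.⇒ B} {g : B C.⇒ C} → F₁ (g C.∘ f) D.≈ F₁ g D.∘ F₁ f

idF : ∀ {o ℓ e} {𝒞 : Category o ℓ e} → Functor 𝒞 𝒞
idF {𝒞 = 𝒞} = record
  { F₀ = idᶠ ; F₁ = idᶠ ; F-resp-≈ = idᶠ ; identity = ≈-refl ; homomorphism = ≈-refl }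
  where open Category 𝒞

infixr 9 _∘F_
_∘F_ : ∀ {o ℓ e o′ ℓ′ e′ o″ ℓ″ e″}
         {𝒞 : Category o ℓ e} {𝒟 : Category o′ ℓ′ e′} {ℰ : Category o″ ℓ″ e″} →
       Functor 𝒟 ℰ → Functor 𝒞 𝒟 → Functor 𝒞 ℰ
_∘F_ {ℰ = ℰ} G F = record
  { F₀ = G.F₀ · F.F₀
  ; F₁ = λ f → G.F₁ (F.F₁ f)
  ; F-resp-≈ = λ p → G.F-resp-≈ (F.F-resp-≈ p)
  ; identity = ≈-trans (G.F-resp-≈ F.identity) G.identity
  ; homomorphism = ≈-trans (G.F-resp-≈ F.homomorphism) G.homomorphism
  }
  where
    open Category ℰ
    module F = Functor F
    module G = Functor G

infix 4 _≡F_
record _≡F_ {o ℓ e o′ ℓ′ e′} {𝒞 : Category o ℓ e} {𝒟 : Category o′ ℓ′ e′}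
            (F G : Functor 𝒞 𝒟) : Set (o ⊔ ℓ ⊔ o′ ⊔ e′) where
  private
    module C = Category 𝒞
    module D = Category 𝒟
    module F = Functor F
    module G = Functor G
  field
    eq₀ : ∀ X → F.F₀ X ≡ G.F₀ X
    eq₁ : ∀ {X Y} (f : X C.⇒ Y) → subst₂ D._⇒_ (eq₀ X) (eq₀ Y) (F.F₁ f) D.≈ G.F₁ f

infix 4 _≅_
record _≅_ {o ℓ e o′ ℓ′ e′} (𝒞 : Category o ℓ e) (𝒟 : Category o′ ℓ′ e′)
       : Set (o ⊔ ℓ ⊔ e ⊔ o′ ⊔ ℓ′ ⊔ e′) where
  field
    to      : Functor 𝒞 𝒟
    from    : Functor 𝒟 𝒞
    from∘to : from ∘F to ≡F idF
    to∘from : to ∘F from ≡F idF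

module _ {o ℓ e} (𝒞 : Category o ℓ e) where
  open Category 𝒞

  record Subobject (A : Obj) : Set (o ⊔ ℓ ⊔ e) where
    field
      {dom} : Obj
      arr   : dom ⇒ A
      mono  : Mono arr

module Subobjects {o ℓ e} (𝒞 : Category o ℓ e) where
  open Category 𝒞
  open Subobject

  infix 4 _∈_ _≤_ _≃_

  -- A generalised element of A belongs to a subobject if it factors through it.
  _∈_ : ∀ {T A} → T ⇒ A → Subobject 𝒞 A → Set (ℓ ⊔ e)
  a ∈ S = Σ[ h ∈ _ ⇒ dom S ] arr S ∘ h ≈ a

  _≤_ : ∀ {A} → Subobject 𝒞 A → Subobject 𝒞 A → Set (ℓ ⊔ e)
  R ≤ S = arr R ∈ S

  _≃_ : ∀ {A} → Subobject 𝒞 A → Subobject 𝒞 A → Set (ℓ ⊔ e)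
  R ≃ S = (R ≤ S) ∧ (S ≤ R)

  ∈-resp : ∀ {T A} {a b : T ⇒ A} {S : Subobject 𝒞 A} → a ≈ b → a ∈ S → b ∈ S
  ∈-resp p (h , q) = h , ≈-trans q p

  ∈-∘ : ∀ {T T′ A} {a : T ⇒ A} {S : Subobject 𝒞 A} (t : T′ ⇒ T) → a ∈ S → a ∘ t ∈ S
  ∈-∘ t (h , q) = h ∘ t , pullˡ q

  arr∈ : ∀ {A} (S : Subobject 𝒞 A) → arr S ∈ S
  arr∈ S = id , identityʳ

  ≤-elim : ∀ {T A} {a : T ⇒ A} {R S : Subobject 𝒞 A} → R ≤ S → a ∈ R → a ∈ S
  ≤-elim {S = S} le (h , q) = ∈-resp {S = S} q (∈-∘ {S = S} h le)

  ≃-isEquivalence : ∀ {A} → IsEquivalence (_≃_ {A})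
  ≃-isEquivalence = record
    { refl  = λ {S} → arr∈ S , arr∈ S
    ; sym   = λ (p , q) → q , p
    ; trans = λ {R} {S} {T} (p , q) (p′ , q′) →
        ≤-elim {R = S} {S = T} p′ p , ≤-elim {R = S} {S = R} q q′
    }

record FinitelyComplete {o ℓ e} (𝒞 : Category o ℓ e) : Set (o ⊔ ℓ ⊔ e) where
  open Category 𝒞
  infixr 7 _×_
  field
    ⊤        : Obj
    !        : ∀ {A} → A ⇒ ⊤
    !-unique : ∀ {A} (f : A ⇒ ⊤) → ! ≈ f

    _×_      : Obj → Obj → Obj
    π₁       : ∀ {A B} → A × B ⇒ A
    π₂       : ∀ {A B} → A × B ⇒ B
    ⟨_,_⟩    : ∀ {A B Z} → Z ⇒ A → Z ⇒ B → Z ⇒ A × B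
    project₁ : ∀ {A B Z} {f : Z ⇒ A} {g : Z ⇒ B} → π₁ ∘ ⟨ f , g ⟩ ≈ f
    project₂ : ∀ {A B Z} {f : Z ⇒ A} {g : Z ⇒ B} → π₂ ∘ ⟨ f , g ⟩ ≈ g
    ⟨⟩-unique : ∀ {A B Z} {f : Z ⇒ A} {g : Z ⇒ B} {h : Z ⇒ A × B} →
                π₁ ∘ h ≈ f → π₂ ∘ h ≈ g → ⟨ f , g ⟩ ≈ h

    Eq           : ∀ {A B} → A ⇒ B → A ⇒ B → Obj
    equalizer    : ∀ {A B} (f g : A ⇒ B) → Eq f g ⇒ A
    equalizes    : ∀ {A B} {f g : A ⇒ B} → f ∘ equalizer f g ≈ g ∘ equalizer f g
    equalize     : ∀ {A B Z} {f g : A ⇒ B} {h : Z ⇒ A} → f ∘ h ≈ g ∘ h → Z ⇒ Eq f g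
    equalizer∘equalize : ∀ {A B Z} {f g : A ⇒ B} {h : Z ⇒ A} (p : f ∘ h ≈ g ∘ h) →
                         equalizer f g ∘ equalize p ≈ h
    equalize-unique : ∀ {A B Z} {f g : A ⇒ B} {h : Z ⇒ A} (p : f ∘ h ≈ g ∘ h)
                      {k : Z ⇒ Eq f g} → equalizer f g ∘ k ≈ h → equalize p ≈ k

  infixr 8 _⁂_
  _⁂_ : ∀ {A B C D} → A ⇒ C → B ⇒ D → A × B ⇒ C × D
  f ⁂ g = ⟨ f ∘ π₁ , g ∘ π₂ ⟩

  swap : ∀ {A B} → A × B ⇒ B × A
  swap = ⟨ π₂ , π₁ ⟩

  assocʳ : ∀ {A B C} → (A × B) × C ⇒ A × (B × C)
  assocʳ = ⟨ π₁ ∘ π₁ , ⟨ π₂ ∘ π₁ , π₂ ⟩ ⟩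

  ×-ext : ∀ {A B Z} {g h : Z ⇒ A × B} → π₁ ∘ g ≈ π₁ ∘ h → π₂ ∘ g ≈ π₂ ∘ h → g ≈ h
  ×-ext p q = ≈-trans (≈-sym (⟨⟩-unique p q)) (⟨⟩-unique ≈-refl ≈-refl)

  ⟨⟩-cong : ∀ {A B Z} {f f′ : Z ⇒ A} {g g′ : Z ⇒ B} →
            f ≈ f′ → g ≈ g′ → ⟨ f , g ⟩ ≈ ⟨ f′ , g′ ⟩
  ⟨⟩-cong p q = ⟨⟩-unique (≈-trans project₁ (≈-sym p)) (≈-trans project₂ (≈-sym q))

  ⟨⟩∘ : ∀ {A B Z W} {f : Z ⇒ A} {g : Z ⇒ B} {h : W ⇒ Z} →
        ⟨ f , g ⟩ ∘ h ≈ ⟨ f ∘ h , g ∘ h ⟩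
  ⟨⟩∘ = ≈-sym (⟨⟩-unique (pullˡ project₁) (pullˡ project₂))

  ⁂∘⟨⟩ : ∀ {A B C D Z} {f : A ⇒ C} {g : B ⇒ D} {h : Z ⇒ A} {k : Z ⇒ B} →
         (f ⁂ g) ∘ ⟨ h , k ⟩ ≈ ⟨ f ∘ h , g ∘ k ⟩
  ⁂∘⟨⟩ = ≈-trans ⟨⟩∘ (⟨⟩-cong (pullʳ project₁) (pullʳ project₂))

  η-× : ∀ {A B Z} {h : Z ⇒ A × B} → ⟨ π₁ ∘ h , π₂ ∘ h ⟩ ≈ h
  η-× = ⟨⟩-unique ≈-refl ≈-refl

  equalizer-mono : ∀ {A B} {f g : A ⇒ B} → Mono (equalizer f g)
  equalizer-mono {f = f} {g} u v p =
    ≈-trans (≈-sym (equalize-unique c p)) (equalize-unique c ≈-refl)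
    where
      c : f ∘ (equalizer f g ∘ v) ≈ g ∘ (equalizer f g ∘ v)
      c = ≈-trans (pullˡ equalizes) assoc

  module _ {A B D} (f : A ⇒ D) (g : B ⇒ D) where
    Pb : Obj
    Pb = Eq (f ∘ π₁) (g ∘ π₂)

    pb₁ : Pb ⇒ A
    pb₁ = π₁ ∘ equalizer (f ∘ π₁) (g ∘ π₂)

    pb₂ : Pb ⇒ B
    pb₂ = π₂ ∘ equalizer (f ∘ π₁) (g ∘ π₂)

    pb-isPullback : IsPullback pb₁ pb₂ f g
    pb-isPullback = record
      { commute     = ≈-trans (≈-sym assoc) (≈-trans equalizes assoc)
      ; universal   = λ c → equalize (lift c)
      ; p∘universal = λ c → ≈-trans (pullʳ (equalizer∘equalize (lift c))) project₁
      ; q∘universal = λ c → ≈-trans (pullʳ (equalizer∘equalize (lift c))) project₂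
      ; unique      = λ p q → equalizer-mono _ _
          (×-ext (≈-trans (≈-sym assoc) (≈-trans p assoc))
                 (≈-trans (≈-sym assoc) (≈-trans q assoc)))
      }
      where
        lift : ∀ {Z} {h : Z ⇒ A} {k : Z ⇒ B} → f ∘ h ≈ g ∘ k →
               (f ∘ π₁) ∘ ⟨ h , k ⟩ ≈ (g ∘ π₂) ∘ ⟨ h , k ⟩
        lift c = ≈-trans (pullʳ project₁) (≈-trans c (≈-sym (pullʳ project₂)))

-- The structure is kept separate from its laws, so that one can assert that
-- a prescribed family of morphisms satisfies the laws.
record StrongMonadData {o ℓ e} {𝒞 : Category o ℓ e} (L : FinitelyComplete 𝒞)
       : Set (o ⊔ ℓ) where
  open Category 𝒞
  open FinitelyComplete L
  field
    F₀ : Obj → Obj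
    F₁ : ∀ {X Y} → X ⇒ Y → F₀ X ⇒ F₀ Y
    η  : ∀ {X} → X ⇒ F₀ X
    μ  : ∀ {X} → F₀ (F₀ X) ⇒ F₀ X
    t  : ∀ {X Y} → X × F₀ Y ⇒ F₀ (X × Y)

  t′ : ∀ {X Y} → F₀ X × Y ⇒ F₀ (X × Y)
  t′ = F₁ swap ∘ t ∘ swap

module _ {o ℓ e} {𝒞 : Category o ℓ e} {L : FinitelyComplete 𝒞} (M : StrongMonadData L) where
  open Category 𝒞
  open FinitelyComplete L
  open StrongMonadData M

  record IsMonad : Set (o ⊔ ℓ ⊔ e) where
    field
      F-resp-≈     : ∀ {X Y} {f g : X ⇒ Y} → f ≈ g → F₁ f ≈ F₁ g
      F-identity   : ∀ {X} → F₁ (id {X}) ≈ id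
      homomorphism : ∀ {X Y Z} {f : X ⇒ Y} {g : Y ⇒ Z} → F₁ (g ∘ f) ≈ F₁ g ∘ F₁ f
      η-natural    : ∀ {X Y} {f : X ⇒ Y} → η ∘ f ≈ F₁ f ∘ η
      μ-natural    : ∀ {X Y} {f : X ⇒ Y} → μ ∘ F₁ (F₁ f) ≈ F₁ f ∘ μ
      μ-assoc      : ∀ {X} → μ {X} ∘ F₁ μ ≈ μ ∘ μ
      μ-identityˡ  : ∀ {X} → μ {X} ∘ F₁ η ≈ id
      μ-identityʳ  : ∀ {X} → μ {X} ∘ η ≈ id

  record IsStrength : Set (o ⊔ ℓ ⊔ e) where
    field
      t-natural : ∀ {X X′ Y Y′} {f : X ⇒ X′} {g : Y ⇒ Y′} →
                  t ∘ (f ⁂ F₁ g) ≈ F₁ (f ⁂ g) ∘ t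
      t-unit    : ∀ {Y} → F₁ π₂ ∘ t {⊤} {Y} ≈ π₂
      t-assoc   : ∀ {X Y Z} → F₁ assocʳ ∘ t {X × Y} {Z} ≈ t ∘ (id ⁂ t) ∘ assocʳ
      t-η       : ∀ {X Y} → t {X} {Y} ∘ (id ⁂ η) ≈ η
      t-μ       : ∀ {X Y} → t {X} {Y} ∘ (id ⁂ μ) ≈ μ ∘ F₁ t ∘ t

  record IsCommutativeMonad : Set (o ⊔ ℓ ⊔ e) where
    field
      isMonad     : IsMonad
      isStrength  : IsStrength
      commutative : ∀ {X Y} → μ ∘ F₁ t′ ∘ t {F₀ X} {Y} ≈ μ ∘ F₁ t ∘ t′

  Kleisli : IsMonad → Category o ℓ e
  Kleisli isMonad = record
    { Obj = Obj
    ; _⇒_ = λ X Y → X ⇒ F₀ Y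
    ; _≈_ = _≈_
    ; id  = η
    ; _∘_ = λ g f → μ ∘ F₁ g ∘ f
    ; equiv = equiv
    ; ∘-resp-≈ = λ p q → ∘-resp-≈ʳ (∘-resp-≈ (F-resp-≈ p) q)
    ; assoc = λ {_} {_} {_} {_} {f} {g} {h} → begin
        μ ∘ F₁ (μ ∘ F₁ h ∘ g) ∘ f
          ≈⟨ ∘-resp-≈ʳ (∘-resp-≈ˡ (≈-trans homomorphism (∘-resp-≈ʳ homomorphism))) ⟩
        μ ∘ (F₁ μ ∘ F₁ (F₁ h) ∘ F₁ g) ∘ f
          ≈⟨ ∘-resp-≈ʳ assoc ⟩
        μ ∘ F₁ μ ∘ (F₁ (F₁ h) ∘ F₁ g) ∘ f
          ≈⟨ pullˡ μ-assoc ⟩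
        (μ ∘ μ) ∘ (F₁ (F₁ h) ∘ F₁ g) ∘ f
          ≈⟨ ≈-trans assoc (∘-resp-≈ʳ (∘-resp-≈ʳ assoc)) ⟩
        μ ∘ μ ∘ F₁ (F₁ h) ∘ F₁ g ∘ f
          ≈⟨ ∘-resp-≈ʳ (≈-trans (pullˡ μ-natural) assoc) ⟩
        μ ∘ F₁ h ∘ μ ∘ F₁ g ∘ f
          ∎
    ; identityˡ = ≈-trans (pullˡ μ-identityˡ) identityˡ
    ; identityʳ = λ {_} {_} {f} →
        ≈-trans (∘-resp-≈ʳ (≈-sym η-natural)) (≈-trans (pullˡ μ-identityʳ) identityˡ)
    }
    where open IsMonad isMonad

module _ {o ℓ e} {𝒞 : Category o ℓ e} (L : FinitelyComplete 𝒞) where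
  open Category 𝒞
  open FinitelyComplete L

  record PowerObject (X : Obj) : Set (o ⊔ ℓ ⊔ e) where
    field
      {P E}  : Obj
      ∈ᴾ     : E ⇒ X × P
      ∈ᴾ-mono : Mono ∈ᴾ
      ξ      : ∀ {Y R} (m : R ⇒ X × Y) → Mono m → Y ⇒ P
      ξ-pullback : ∀ {Y R} (m : R ⇒ X × Y) (mono : Mono m) →
                   Σ[ n ∈ R ⇒ E ] IsPullback m n (id ⁂ ξ m mono) ∈ᴾ
      ξ-unique   : ∀ {Y R} (m : R ⇒ X × Y) (mono : Mono m) {k : Y ⇒ P} →
                   Σ[ n ∈ R ⇒ E ] IsPullback m n (id ⁂ k) ∈ᴾ → k ≈ ξ m mono

record Topos (o ℓ e : Level) : Set (suc (o ⊔ ℓ ⊔ e)) where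
  field
    category         : Category o ℓ e
    finitelyComplete : FinitelyComplete category
    powerObject      : ∀ X → PowerObject finitelyComplete X

module ToposProperties {o ℓ e} (𝒯 : Topos o ℓ e) where
  open Topos 𝒯
  open Category category
  open FinitelyComplete finitelyComplete
  open Subobject
  open Subobjects category

  private
    module Power (X : Obj) = PowerObject (powerObject X)
    Sub : Obj → Set (o ⊔ ℓ ⊔ e)
    Sub = Subobject category

  𝒫 : Obj → Obj
  𝒫 X = Power.P X

  Relation : Obj → Obj → Set (o ⊔ ℓ ⊔ e)
  Relation X Y = Sub (X × Y)

  ∈[_] : ∀ X → Relation X (𝒫 X)
  ∈[ X ] = record { arr = Power.∈ᴾ X ; mono = Power.∈ᴾ-mono X }

  ξ : ∀ {X Y} → Relation X Y → Y ⇒ 𝒫 X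
  ξ {X} r = Power.ξ X (arr r) (mono r)

  private
    split : ∀ {X Y Z T} {k : Y ⇒ Z} {a : T ⇒ X × Y} →
            (id ⁂ k) ∘ a ≈ ⟨ π₁ ∘ a , k ∘ π₂ ∘ a ⟩
    split = ≈-trans ⟨⟩∘ (⟨⟩-cong (≈-trans assoc identityˡ) assoc)

  ξ-elim : ∀ {X Y T} (r : Relation X Y) {x : T ⇒ X} {y : T ⇒ Y} →
           ⟨ x , ξ r ∘ y ⟩ ∈ ∈[ X ] → ⟨ x , y ⟩ ∈ r
  ξ-elim {X} r (h , q) = universal c , p∘universal c
    where
      open IsPullback (proj₂ (Power.ξ-pullback X (arr r) (mono r)))
      c : (id ⁂ ξ r) ∘ _ ≈ Power.∈ᴾ X ∘ h
      c = ≈-trans ⁂∘⟨⟩ (≈-trans (⟨⟩-cong identityˡ ≈-refl) (≈-sym q))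

  ξ-intro : ∀ {X Y T} (r : Relation X Y) {x : T ⇒ X} {y : T ⇒ Y} →
            ⟨ x , y ⟩ ∈ r → ⟨ x , ξ r ∘ y ⟩ ∈ ∈[ X ]
  ξ-intro {X} r {x} {y} (h , q) = n ∘ h , (begin
      Power.∈ᴾ X ∘ n ∘ h       ≈⟨ pullˡ (≈-sym commute) ⟩
      ((id ⁂ ξ r) ∘ arr r) ∘ h ≈⟨ pullʳ q ⟩
      (id ⁂ ξ r) ∘ ⟨ x , y ⟩   ≈⟨ ⁂∘⟨⟩ ⟩
      ⟨ id ∘ x , ξ r ∘ y ⟩     ≈⟨ ⟨⟩-cong identityˡ ≈-refl ⟩
      ⟨ x , ξ r ∘ y ⟩          ∎)
    where
      n = proj₁ (Power.ξ-pullback X (arr r) (mono r))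
      open IsPullback (proj₂ (Power.ξ-pullback X (arr r) (mono r)))

  ξ-char : ∀ {X Y} (r : Relation X Y) {k : Y ⇒ 𝒫 X} →
           (∀ {T} {x : T ⇒ X} {y : T ⇒ Y} → ⟨ x , y ⟩ ∈ r → ⟨ x , k ∘ y ⟩ ∈ ∈[ X ]) →
           (∀ {T} {x : T ⇒ X} {y : T ⇒ Y} → ⟨ x , k ∘ y ⟩ ∈ ∈[ X ] → ⟨ x , y ⟩ ∈ r) →
           k ≈ ξ r
  ξ-char {X} r {k} intro elim = Power.ξ-unique X (arr r) (mono r) (n , record
    { commute     = comm
    ; universal   = λ c → proj₁ (el c)
    ; p∘universal = λ c → ≈-trans (proj₂ (el c)) η-×
    ; q∘universal = λ {_} {h} {h′} c → Power.∈ᴾ-mono X _ _ (begin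
        Power.∈ᴾ X ∘ n ∘ proj₁ (el c)          ≈⟨ pullˡ (≈-sym comm) ⟩
        ((id ⁂ k) ∘ arr r) ∘ proj₁ (el c)     ≈⟨ pullʳ (≈-trans (proj₂ (el c)) η-×) ⟩
        (id ⁂ k) ∘ h                          ≈⟨ c ⟩
        Power.∈ᴾ X ∘ h′                        ∎)
    ; unique      = λ p _ → mono r _ _ p
    })
    where
      mem = intro (∈-resp {S = r} (≈-sym η-×) (arr∈ r))
      n = proj₁ mem
      comm : (id ⁂ k) ∘ arr r ≈ Power.∈ᴾ X ∘ n
      comm = ≈-trans split (≈-sym (proj₂ mem))
      el : ∀ {Z} {h : Z ⇒ X × _} {h′ : Z ⇒ Power.E X} →
           (id ⁂ k) ∘ h ≈ Power.∈ᴾ X ∘ h′ → ⟨ π₁ ∘ h , π₂ ∘ h ⟩ ∈ r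
      el {_} {h} {h′} c = elim (h′ , ≈-trans (≈-sym c) split)

  preimage : ∀ {A B} → A ⇒ B → Sub B → Sub A
  preimage f S = record
    { arr  = pb₁ f (arr S)
    ; mono = λ g h p → unique p (mono S _ _ (begin
        arr S ∘ pb₂ f (arr S) ∘ g   ≈⟨ pullˡ (≈-sym commute) ⟩
        (f ∘ pb₁ f (arr S)) ∘ g     ≈⟨ pullʳ p ⟩
        f ∘ pb₁ f (arr S) ∘ h       ≈⟨ pullˡ commute ⟩
        (arr S ∘ pb₂ f (arr S)) ∘ h ≈⟨ assoc ⟩
        arr S ∘ pb₂ f (arr S) ∘ h   ∎))
    }
    where open IsPullback (pb-isPullback f (arr S))

  preimage-intro : ∀ {A B T} (f : A ⇒ B) (S : Sub B) {a : T ⇒ A} →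
                   f ∘ a ∈ S → a ∈ preimage f S
  preimage-intro f S (h , q) = universal (≈-sym q) , p∘universal (≈-sym q)
    where open IsPullback (pb-isPullback f (arr S))

  preimage-elim : ∀ {A B T} (f : A ⇒ B) (S : Sub B) {a : T ⇒ A} →
                  a ∈ preimage f S → f ∘ a ∈ S
  preimage-elim f S (h , q) =
    pb₂ f (arr S) ∘ h , ≈-trans (pullˡ (≈-sym commute)) (pullʳ q)
    where open IsPullback (pb-isPullback f (arr S))

  𝒫-ext : ∀ {X Y} {k k′ : Y ⇒ 𝒫 X} →
          (∀ {T} {x : T ⇒ X} {y : T ⇒ Y} → ⟨ x , k ∘ y ⟩ ∈ ∈[ X ] → ⟨ x , k′ ∘ y ⟩ ∈ ∈[ X ]) →
          (∀ {T} {x : T ⇒ X} {y : T ⇒ Y} → ⟨ x , k′ ∘ y ⟩ ∈ ∈[ X ] → ⟨ x , k ∘ y ⟩ ∈ ∈[ X ]) →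
          k ≈ k′
  𝒫-ext {X} {Y} {k} {k′} fwd bwd =
    ≈-trans (ξ-char r elim intro) (≈-sym (ξ-char r (fwd · elim) (intro · bwd)))
    where
      r : Relation X Y
      r = preimage (id ⁂ k) ∈[ X ]
      id⁂k : ∀ {T} {x : T ⇒ X} {y : T ⇒ Y} → (id ⁂ k) ∘ ⟨ x , y ⟩ ≈ ⟨ x , k ∘ y ⟩
      id⁂k = ≈-trans ⁂∘⟨⟩ (⟨⟩-cong identityˡ ≈-refl)
      elim : ∀ {T} {x : T ⇒ X} {y : T ⇒ Y} → ⟨ x , y ⟩ ∈ r → ⟨ x , k ∘ y ⟩ ∈ ∈[ X ]
      elim p = ∈-resp {S = ∈[ X ]} id⁂k (preimage-elim (id ⁂ k) ∈[ X ] p)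
      intro : ∀ {T} {x : T ⇒ X} {y : T ⇒ Y} → ⟨ x , k ∘ y ⟩ ∈ ∈[ X ] → ⟨ x , y ⟩ ∈ r
      intro p = preimage-intro (id ⁂ k) ∈[ X ] (∈-resp {S = ∈[ X ]} (≈-sym id⁂k) p)

  -- All r s is {y | ∀ x. r(x,y) ⇒ s(x,y)}
  module _ {X Y} (r s : Relation X Y) where
    private
      r∩s : Relation X Y
      r∩s = record
        { arr  = arr r ∘ arr (preimage (arr r) s)
        ; mono = λ g h p → mono (preimage (arr r) s) _ _
            (mono r _ _ (≈-trans (≈-sym assoc) (≈-trans p assoc)))
        }

      ∩-intro : ∀ {T} {a : T ⇒ X × Y} → a ∈ r → a ∈ s → a ∈ r∩s
      ∩-intro (h , q) m with preimage-intro (arr r) s (∈-resp {S = s} (≈-sym q) m)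
      ... | (k , q′) = k , ≈-trans (pullʳ q′) q

      ∩-elim₁ : ∀ {T} {a : T ⇒ X × Y} → a ∈ r∩s → a ∈ r
      ∩-elim₁ (k , q) = _ ∘ k , ≈-trans (≈-sym assoc) q

      ∩-elim₂ : ∀ {T} {a : T ⇒ X × Y} → a ∈ r∩s → a ∈ s
      ∩-elim₂ (k , q) = ∈-resp {S = s} (≈-trans (≈-sym assoc) q)
        (preimage-elim (arr r) s (k , ≈-refl))

    All : Sub Y
    All = record { arr = equalizer (ξ r) (ξ r∩s) ; mono = equalizer-mono }

    All-elim : ∀ {T S} {y : T ⇒ Y} → y ∈ All → (u : S ⇒ T) {x : S ⇒ X} →
               ⟨ x , y ∘ u ⟩ ∈ r → ⟨ x , y ∘ u ⟩ ∈ s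
    All-elim {y = y} (h , q) u m =
      ∩-elim₂ (ξ-elim r∩s (∈-resp {S = ∈[ X ]} (⟨⟩-cong ≈-refl eq) (ξ-intro r m)))
      where
        eq : ξ r ∘ y ∘ u ≈ ξ r∩s ∘ y ∘ u
        eq = ≈-trans (≈-sym assoc) (≈-trans (∘-resp-≈ˡ (begin
          ξ r ∘ y                  ≈⟨ ∘-resp-≈ʳ (≈-sym q) ⟩
          ξ r ∘ equalizer _ _ ∘ h  ≈⟨ pullˡ equalizes ⟩
          (ξ r∩s ∘ equalizer _ _) ∘ h ≈⟨ pullʳ q ⟩
          ξ r∩s ∘ y                ∎)) assoc)

    All-intro : ∀ {T} {y : T ⇒ Y} →
                (∀ {S} (u : S ⇒ T) {x : S ⇒ X} → ⟨ x , y ∘ u ⟩ ∈ r → ⟨ x , y ∘ u ⟩ ∈ s) →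
                y ∈ All
    All-intro {y = y} H = equalize eq , equalizer∘equalize eq
      where
        into : ∀ {T} {x : T ⇒ X} {v w : T ⇒ 𝒫 X} →
               v ≈ w → ⟨ x , v ⟩ ∈ ∈[ X ] → ⟨ x , w ⟩ ∈ ∈[ X ]
        into p = ∈-resp {S = ∈[ X ]} (⟨⟩-cong ≈-refl p)
        eq : ξ r ∘ y ≈ ξ r∩s ∘ y
        eq = 𝒫-ext
          (λ {_} {_} {u} m → let m′ = ξ-elim r (into assoc m) in
             into (≈-sym assoc) (ξ-intro r∩s (∩-intro m′ (H u m′))))
          (λ m → into (≈-sym assoc) (ξ-intro r (∩-elim₁ (ξ-elim r∩s (into assoc m)))))

  -- The image is the intersection of all subobjects through which f factors,
  -- formed internally; no factorisations are assumed.  It is opaque only to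
  -- keep terms small.
  module _ {X Y} (f : X ⇒ Y) where
    private
      total : ∀ {A} → Sub A
      total = record { arr = id ; mono = λ _ _ p →
        ≈-trans (≈-sym identityˡ) (≈-trans p identityˡ) }

      f∈U : Relation X (𝒫 Y)
      f∈U = preimage (f ⁂ id) ∈[ Y ]

      containing : Sub (𝒫 Y)
      containing = All total f∈U

      U-contains-f U∋y : Relation (𝒫 Y) Y
      U-contains-f = preimage π₁ containing
      U∋y          = preimage swap ∈[ Y ]

      swap⟨⟩ : ∀ {A B T} {a : T ⇒ A} {b : T ⇒ B} → swap ∘ ⟨ a , b ⟩ ≈ ⟨ b , a ⟩
      swap⟨⟩ = ≈-trans ⟨⟩∘ (⟨⟩-cong project₂ project₁)

    opaque
      imageOf : Sub Y
      imageOf = All U-contains-f U∋y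

      f∈image : f ∈ imageOf
      f∈image = All-intro U-contains-f U∋y λ u {U} m →
        let c = ∈-resp {S = containing} project₁ (preimage-elim π₁ containing m)
            d = All-elim total f∈U c id {u} (⟨ u , U ∘ id ⟩ , identityˡ)
            d′ = preimage-elim (f ⁂ id) ∈[ Y ] d
        in preimage-intro swap ∈[ Y ] (∈-resp {S = ∈[ Y ]}
             (≈-trans ⁂∘⟨⟩ (≈-trans (⟨⟩-cong ≈-refl (≈-trans identityˡ identityʳ)) (≈-sym swap⟨⟩)))
             d′)

      image-least : (S : Sub Y) → f ∈ S → imageOf ≤ S
      image-least S f∈S =
        ∈-resp {S = S} (≈-trans project₁ identityʳ)
          (preimage-elim π₁ S (ξ-elim name (∈-resp {S = ∈[ Y ]} swap⟨⟩
            (preimage-elim swap ∈[ Y ]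
              (All-elim U-contains-f U∋y (arr∈ imageOf) id {ξ name ∘ !}
                (preimage-intro π₁ containing (∈-resp {S = containing} (≈-sym project₁) named)))))))
        where
          name : Relation Y ⊤
          name = preimage π₁ S
          named : ∀ {T} → ξ name ∘ ! {T} ∈ containing
          named = All-intro total f∈U λ u {x} _ → preimage-intro (f ⁂ id) ∈[ Y ]
            (∈-resp {S = ∈[ Y ]}
              (≈-sym (≈-trans ⁂∘⟨⟩ (⟨⟩-cong ≈-refl (≈-trans identityˡ assoc))))
              (ξ-intro name (preimage-intro π₁ S
                (∈-resp {S = S} (≈-sym project₁) (∈-∘ {S = S} x f∈S)))))

  -- A morphism is a cover if it factors through no proper subobject.
  Cover : ∀ {A B} → A ⇒ B → Set (o ⊔ ℓ ⊔ e)
  Cover {B = B} q = (S : Sub B) → q ∈ S → id ∈ S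

  cover⇒epi : ∀ {A B} {q : A ⇒ B} → Cover q → Epi q
  cover⇒epi cover g h p with cover (record { arr = equalizer g h ; mono = equalizer-mono })
                                   (equalize p , equalizer∘equalize p)
  ... | (k , q) = begin
    g                     ≈⟨ identityʳ ⟨
    g ∘ id                ≈⟨ ∘-resp-≈ʳ q ⟨
    g ∘ equalizer g h ∘ k ≈⟨ ≈-trans (pullˡ equalizes) assoc ⟩
    h ∘ equalizer g h ∘ k ≈⟨ ∘-resp-≈ʳ q ⟩
    h ∘ id                ≈⟨ identityʳ ⟩
    h                     ∎

  image-cover : ∀ {X Y} (f : X ⇒ Y) → Cover (proj₁ (f∈image f))
  image-cover f S (h , q) = k , mono (imageOf f) _ _ (≈-trans (≈-sym assoc) (≈-trans q′ (≈-sym identityʳ)))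
    where
      S′ : Sub _
      S′ = record
        { arr  = arr (imageOf f) ∘ arr S
        ; mono = λ g h p → mono S _ _ (mono (imageOf f) _ _
                   (≈-trans (≈-sym assoc) (≈-trans p assoc)))
        }
      le = image-least f S′ (h , ≈-trans (pullʳ q) (proj₂ (f∈image f)))
      k  = proj₁ le
      q′ = proj₂ le

  factorise : ∀ {X Y} (f : X ⇒ Y) → EpiMonoFactorisation f
  factorise f = record
    { epiPart  = proj₁ (f∈image f)
    ; monoPart = arr (imageOf f)
    ; epi      = cover⇒epi (image-cover f)
    ; mono     = mono (imageOf f)
    ; factors  = proj₂ (f∈image f)
    }

  -- Every mono in a topos is an equalizer, so this subobject does not depend on
  -- the chosen (epi, mono)-factorisation.
  monoPart : ∀ {X Y} → X ⇒ Y → Subobject category Y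
  monoPart f = record { arr = F.monoPart ; mono = F.mono }
    where module F = EpiMonoFactorisation (factorise f)

  -- With ∀S = {d | ∀ b. g b = d ⇒ b ∈ S}, the projection factors through S iff q
  -- factors through ∀S.
  pullback-cover : ∀ {A B D} (q : A ⇒ D) (g : B ⇒ D) → Cover q → Cover (pb₂ q g)
  pullback-cover {A} {B} {D} q g cover S (h , p) =
    ∈-resp {S = S} project₁ (preimage-elim π₁ S
      (All-elim graph inS (∈-resp {S = ∀S} identityˡ (∈-∘ {S = ∀S} g (cover ∀S q∈∀S))) id {id}
        (graph-intro (≈-trans identityʳ (≈-sym identityʳ)))))
    where
      graph inS : Relation B D
      graph = record { arr = equalizer (g ∘ π₁) π₂ ; mono = equalizer-mono }
      inS   = preimage π₁ S
      ∀S : Sub D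
      ∀S = All graph inS
      graph-intro : ∀ {T} {b : T ⇒ B} {d : T ⇒ D} → g ∘ b ≈ d → ⟨ b , d ⟩ ∈ graph
      graph-intro {b = b} {d} c = equalize c′ , equalizer∘equalize c′
        where
          c′ : (g ∘ π₁) ∘ ⟨ b , d ⟩ ≈ π₂ ∘ ⟨ b , d ⟩
          c′ = ≈-trans (pullʳ project₁) (≈-trans c (≈-sym project₂))
      graph-elim : ∀ {T} {b : T ⇒ B} {d : T ⇒ D} → ⟨ b , d ⟩ ∈ graph → g ∘ b ≈ d
      graph-elim {b = b} {d} (k , r) = begin
        g ∘ b                     ≈⟨ pullʳ project₁ ⟨
        (g ∘ π₁) ∘ ⟨ b , d ⟩      ≈⟨ ∘-resp-≈ʳ r ⟨
        (g ∘ π₁) ∘ equalizer _ _ ∘ k ≈⟨ ≈-trans (pullˡ equalizes) assoc ⟩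
        π₂ ∘ equalizer _ _ ∘ k    ≈⟨ ∘-resp-≈ʳ r ⟩
        π₂ ∘ ⟨ b , d ⟩            ≈⟨ project₂ ⟩
        d                         ∎
      open IsPullback (pb-isPullback q g)
      q∈∀S : q ∈ ∀S
      q∈∀S = All-intro graph inS λ u {b} m →
        let c = ≈-sym (graph-elim m) in
        preimage-intro π₁ S (∈-resp {S = S} (≈-sym project₁)
          (∈-resp {S = S} (q∘universal c) (∈-∘ {S = S} (universal c) (h , p))))

  cover-elim : ∀ {T T′ A} {q : T′ ⇒ T} → Cover q → (S : Sub A) {a : T ⇒ A} →
               a ∘ q ∈ S → a ∈ S
  cover-elim cover S {a} m =
    ∈-resp {S = S} identityʳ (preimage-elim a S (cover (preimage a S) (preimage-intro a S m)))

  monoPart-intro : ∀ {X Y T} (f : X ⇒ Y) (x : T ⇒ X) → f ∘ x ∈ monoPart f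
  monoPart-intro f x = ∈-∘ {S = monoPart f} x (f∈image f)

  monoPart-elim : ∀ {X Y T} (f : X ⇒ Y) {y : T ⇒ Y} → y ∈ monoPart f →
                  Σ[ T′ ∈ Obj ] Σ[ q ∈ T′ ⇒ T ] Cover q ∧ (Σ[ x ∈ T′ ⇒ X ] f ∘ x ≈ y ∘ q)
  monoPart-elim f {y} (h , p) =
    Pb ē h , pb₂ ē h , pullback-cover ē h (image-cover f) , pb₁ ē h , (begin
      f ∘ pb₁ ē h                     ≈⟨ ∘-resp-≈ˡ (proj₂ (f∈image f)) ⟨
      (arr (imageOf f) ∘ ē) ∘ pb₁ ē h ≈⟨ pullʳ commute ⟩
      arr (imageOf f) ∘ h ∘ pb₂ ē h   ≈⟨ pullˡ p ⟩
      y ∘ pb₂ ē h                     ∎)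
    where
      ē = proj₁ (f∈image f)
      open IsPullback (pb-isPullback ē h)

  Δ : ∀ {X} → Relation X X
  Δ = record
    { arr  = ⟨ id , id ⟩
    ; mono = λ g h p → begin
        g                     ≈⟨ identityˡ ⟨
        id ∘ g                ≈⟨ pullˡ project₁ ⟨
        π₁ ∘ ⟨ id , id ⟩ ∘ g  ≈⟨ ∘-resp-≈ʳ p ⟩
        π₁ ∘ ⟨ id , id ⟩ ∘ h  ≈⟨ pullˡ project₁ ⟩
        id ∘ h                ≈⟨ identityˡ ⟩
        h                     ∎
    }

  infixr 9 _⨾_
  _⨾_ : ∀ {X Y Z} → Relation X Y → Relation Y Z → Relation X Z
  r ⨾ s = monoPart ⟨ π₁ ∘ arr r ∘ μ₁ , π₂ ∘ arr s ∘ μ₂ ⟩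
    where
      μ₁ = pb₁ (π₂ ∘ arr r) (π₁ ∘ arr s)
      μ₂ = pb₂ (π₂ ∘ arr r) (π₁ ∘ arr s)

  ⨾-intro : ∀ {X Y Z T} (r : Relation X Y) (s : Relation Y Z)
            {x : T ⇒ X} {y : T ⇒ Y} {z : T ⇒ Z} →
            ⟨ x , y ⟩ ∈ r → ⟨ y , z ⟩ ∈ s → ⟨ x , z ⟩ ∈ r ⨾ s
  ⨾-intro r s {x} {y} {z} (h , p) (k , q) =
    ∈-resp {S = r ⨾ s}
      (≈-trans ⟨⟩∘ (⟨⟩-cong
        (≈-trans (pullʳ (pullʳ (p∘universal c))) (≈-trans (∘-resp-≈ʳ p) project₁))
        (≈-trans (pullʳ (pullʳ (q∘universal c))) (≈-trans (∘-resp-≈ʳ q) project₂))))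
      (monoPart-intro _ (universal c))
    where
      open IsPullback (pb-isPullback (π₂ ∘ arr r) (π₁ ∘ arr s))
      c : (π₂ ∘ arr r) ∘ h ≈ (π₁ ∘ arr s) ∘ k
      c = ≈-trans (pullʳ p) (≈-trans project₂ (≈-sym (≈-trans (pullʳ q) project₁)))

  ⨾-elim : ∀ {X Y Z T} (r : Relation X Y) (s : Relation Y Z) {x : T ⇒ X} {z : T ⇒ Z} →
           ⟨ x , z ⟩ ∈ r ⨾ s →
           Σ[ T′ ∈ Obj ] Σ[ q ∈ T′ ⇒ T ] Cover q ∧
             (Σ[ y ∈ T′ ⇒ Y ] (⟨ x ∘ q , y ⟩ ∈ r) ∧ (⟨ y , z ∘ q ⟩ ∈ s))
  ⨾-elim r s {x} {z} m with monoPart-elim _ m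
  ... | (T′ , q , cover , w , p) =
    T′ , q , cover , π₂ ∘ arr r ∘ μ₁ ∘ w
       , (μ₁ ∘ w , ×-ext (≈-trans (≈-trans (∘-resp-≈ʳ (≈-sym assoc)) (≈-trans (≈-sym assoc) eq₁))
                                  (≈-sym project₁))
                         (≈-sym project₂))
       , (μ₂ ∘ w , ×-ext (≈-trans mid (≈-sym project₁))
                         (≈-trans (≈-trans (∘-resp-≈ʳ (≈-sym assoc)) (≈-trans (≈-sym assoc) eq₂))
                                  (≈-sym project₂)))
    where
      μ₁ = pb₁ (π₂ ∘ arr r) (π₁ ∘ arr s)
      μ₂ = pb₂ (π₂ ∘ arr r) (π₁ ∘ arr s)
      open IsPullback (pb-isPullback (π₂ ∘ arr r) (π₁ ∘ arr s))
      eq : ⟨ (π₁ ∘ arr r ∘ μ₁) ∘ w , (π₂ ∘ arr s ∘ μ₂) ∘ w ⟩ ≈ ⟨ x ∘ q , z ∘ q ⟩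
      eq = ≈-trans (≈-sym ⟨⟩∘) (≈-trans p ⟨⟩∘)
      eq₁ : (π₁ ∘ arr r ∘ μ₁) ∘ w ≈ x ∘ q
      eq₁ = ≈-trans (≈-sym project₁) (≈-trans (∘-resp-≈ʳ eq) project₁)
      eq₂ : (π₂ ∘ arr s ∘ μ₂) ∘ w ≈ z ∘ q
      eq₂ = ≈-trans (≈-sym project₂) (≈-trans (∘-resp-≈ʳ eq) project₂)
      mid : π₁ ∘ arr s ∘ μ₂ ∘ w ≈ π₂ ∘ arr r ∘ μ₁ ∘ w
      mid = begin
        π₁ ∘ arr s ∘ μ₂ ∘ w   ≈⟨ ≈-trans (≈-sym assoc) (≈-sym assoc) ⟩
        ((π₁ ∘ arr s) ∘ μ₂) ∘ w ≈⟨ ∘-resp-≈ˡ commute ⟨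
        ((π₂ ∘ arr r) ∘ μ₁) ∘ w ≈⟨ ≈-trans assoc assoc ⟩
        π₂ ∘ arr r ∘ μ₁ ∘ w   ∎

  Δ-intro : ∀ {X T} {x y : T ⇒ X} → x ≈ y → ⟨ x , y ⟩ ∈ Δ
  Δ-intro {x = x} p = x , ≈-trans ⟨⟩∘ (⟨⟩-cong identityˡ (≈-trans identityˡ p))

  Δ-elim : ∀ {X T} {x y : T ⇒ X} → ⟨ x , y ⟩ ∈ Δ → x ≈ y
  Δ-elim {x = x} {y} (h , p) = ≈-trans (≈-trans (≈-sym project₁) (∘-resp-≈ʳ (≈-sym p′)))
    (≈-trans (≈-trans project₁ (≈-sym project₂)) (≈-trans (∘-resp-≈ʳ p′) project₂))
    where
      p′ : ⟨ h , h ⟩ ≈ ⟨ x , y ⟩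
      p′ = ≈-trans (≈-sym (≈-trans ⟨⟩∘ (⟨⟩-cong identityˡ identityˡ))) p

  ≤-fromElements : ∀ {X Y} (r s : Relation X Y) →
    (∀ {T} {x : T ⇒ X} {y : T ⇒ Y} → ⟨ x , y ⟩ ∈ r → ⟨ x , y ⟩ ∈ s) → r ≤ s
  ≤-fromElements r s H = ∈-resp {S = s} η-× (H (∈-resp {S = r} (≈-sym η-×) (arr∈ r)))

  cover-elim₂ : ∀ {X Y T T′} (r : Relation X Y) {x : T ⇒ X} {y : T ⇒ Y} {q : T′ ⇒ T} →
            Cover q → ⟨ x ∘ q , y ∘ q ⟩ ∈ r → ⟨ x , y ⟩ ∈ r
  cover-elim₂ r cover m = cover-elim cover r (∈-resp {S = r} (≈-sym ⟨⟩∘) m)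

  restrict : ∀ {X Y T T′} (r : Relation X Y) {x : T ⇒ X} {y : T ⇒ Y} (q : T′ ⇒ T) →
             ⟨ x , y ⟩ ∈ r → ⟨ x ∘ q , y ∘ q ⟩ ∈ r
  restrict r q m = ∈-resp {S = r} ⟨⟩∘ (∈-∘ {S = r} q m)

  ⨾-mono-≤ : ∀ {X Y Z} (r r′ : Relation X Y) (s s′ : Relation Y Z) →
             r ≤ r′ → s ≤ s′ → r ⨾ s ≤ r′ ⨾ s′
  ⨾-mono-≤ r r′ s s′ p q = ≤-fromElements (r ⨾ s) (r′ ⨾ s′) λ m →
    let (_ , _ , cover , _ , a , b) = ⨾-elim r s m in
    cover-elim₂ (r′ ⨾ s′) cover
      (⨾-intro r′ s′ (≤-elim {R = r} {S = r′} p a) (≤-elim {R = s} {S = s′} q b))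

  ⨾-assoc₁ : ∀ {W X Y Z} (r : Relation W X) (s : Relation X Y) (u : Relation Y Z) →
             r ⨾ (s ⨾ u) ≤ (r ⨾ s) ⨾ u
  ⨾-assoc₁ r s u = ≤-fromElements (r ⨾ (s ⨾ u)) ((r ⨾ s) ⨾ u) λ m →
    let (_ , _  , cover  , _ , a , m′) = ⨾-elim r (s ⨾ u) m
        (_ , q′ , cover′ , _ , b , c)  = ⨾-elim s u m′
    in cover-elim₂ ((r ⨾ s) ⨾ u) cover (cover-elim₂ ((r ⨾ s) ⨾ u) cover′
         (⨾-intro (r ⨾ s) u (⨾-intro r s (restrict r q′ a) b) c))

  ⨾-assoc₂ : ∀ {W X Y Z} (r : Relation W X) (s : Relation X Y) (u : Relation Y Z) →
             (r ⨾ s) ⨾ u ≤ r ⨾ (s ⨾ u)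
  ⨾-assoc₂ r s u = ≤-fromElements ((r ⨾ s) ⨾ u) (r ⨾ (s ⨾ u)) λ m →
    let (_ , _  , cover  , _ , m′ , c) = ⨾-elim (r ⨾ s) u m
        (_ , q′ , cover′ , _ , a , b)  = ⨾-elim r s m′
    in cover-elim₂ (r ⨾ (s ⨾ u)) cover (cover-elim₂ (r ⨾ (s ⨾ u)) cover′
         (⨾-intro r (s ⨾ u) a (⨾-intro s u b (restrict u q′ c))))

  ⨾-identityʳ : ∀ {X Y} (r : Relation X Y) → r ⨾ Δ ≃ r
  ⨾-identityʳ r =
    ≤-fromElements (r ⨾ Δ) r (λ m →
      let (_ , _ , cover , _ , a , b) = ⨾-elim r Δ m in
      cover-elim₂ r cover (∈-resp {S = r} (⟨⟩-cong ≈-refl (Δ-elim b)) a)) ,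
    ≤-fromElements r (r ⨾ Δ) (λ m → ⨾-intro r Δ m (Δ-intro ≈-refl))

  ⨾-identityˡ : ∀ {X Y} (r : Relation X Y) → Δ ⨾ r ≃ r
  ⨾-identityˡ r =
    ≤-fromElements (Δ ⨾ r) r (λ m →
      let (_ , _ , cover , _ , a , b) = ⨾-elim Δ r m in
      cover-elim₂ r cover (∈-resp {S = r} (⟨⟩-cong (≈-sym (Δ-elim a)) ≈-refl) b)) ,
    ≤-fromElements r (Δ ⨾ r) (λ m → ⨾-intro Δ r (Δ-intro ≈-refl) m)

  Rel : Category o (o ⊔ ℓ ⊔ e) (ℓ ⊔ e)
  Rel = record
    { Obj = Obj
    ; _⇒_ = Relation
    ; _≈_ = _≃_
    ; id  = Δ
    ; _∘_ = flip _⨾_   -- _⨾_ is in diagrammatic order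
    ; equiv = ≃-isEquivalence
    ; ∘-resp-≈ = λ {_} {_} {_} {s} {s′} {r} {r′} (p , p′) (q , q′) →
        ⨾-mono-≤ r r′ s s′ q p , ⨾-mono-≤ r′ r s′ s q′ p′
    ; assoc = λ {_} {_} {_} {_} {r} {s} {u} → ⨾-assoc₁ r s u , ⨾-assoc₂ r s u
    ; identityˡ = λ {_} {_} {r} → ⨾-identityʳ r
    ; identityʳ = λ {_} {_} {r} → ⨾-identityˡ r
    }

  powerMonad : StrongMonadData finitelyComplete
  powerMonad = record
    { F₀ = 𝒫
    ; F₁ = λ {X} {Y} f → ξ (monoPart ((f ⁂ id) ∘ arr ∈[ X ]))
    ; η  = ξ Δ
    ; μ  = λ {X} → ξ (∈[ X ] ⨾ ∈[ 𝒫 X ])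
    ; t  = λ {X} {Y} → ξ (monoPart (⟨ id {X} ⁂ π₁ , id ⁂ π₂ ⟩ ∘ (id ⁂ arr ∈[ Y ])))
    }

{-# OPTIONS --safe #-}
module Submission where

-- Two morphisms k, k′ : Y → 𝒫X are equal as soon as, for all generalised elements
-- y of Y, k y and k′ y have the same generalised elements.  In terms of these the
-- structure maps are the familiar ones, f[k], {y}, ⋃K and {x} × k, except that an
-- existential statement holds only after restriction along a cover; since covers
-- are orthogonal to monos, membership may be checked after such a restriction, and
-- all monad and strength laws become elementary set theory.  The Kleisli category
-- is Rel because a relation r from X to Y is the same as x ↦ {y | r(x, y)}.

open import Defs
open import Level using (Level; _⊔_; suc)
open import Data.Product using (Σ-syntax; _,_; proj₁; proj₂) renaming (_×_ to _∧_)
open import Relation.Binary.PropositionalEquality using (refl)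

-- Set theory of generalised elements, as an interface

-- The elimination rules of existential statements are in continuation-passing
-- form, with memberships z ∊ w ∘ a as the only goals; this hides the covers.
record Membership {o ℓ e} {𝒞 : Category o ℓ e} {L : FinitelyComplete 𝒞}
                  (M : StrongMonadData L) (m : Level) : Set (o ⊔ ℓ ⊔ e ⊔ suc m) where
  open Category 𝒞
  open FinitelyComplete L
  open StrongMonadData M
  infix 4 _∊_
  field
    _∊_ : ∀ {T X} → T ⇒ X → T ⇒ F₀ X → Set m
    ∊-resp : ∀ {T X} {x x′ : T ⇒ X} {k k′ : T ⇒ F₀ X} → x ≈ x′ → k ≈ k′ → x ∊ k → x′ ∊ k′
    ∊-∘ : ∀ {T T′ X} {x : T ⇒ X} {k : T ⇒ F₀ X} (q : T′ ⇒ T) → x ∊ k → x ∘ q ∊ k ∘ q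
    ∊-ext : ∀ {X Y} {k k′ : Y ⇒ F₀ X} →
            (∀ {T} {x : T ⇒ X} {y : T ⇒ Y} → x ∊ k ∘ y → x ∊ k′ ∘ y) →
            (∀ {T} {x : T ⇒ X} {y : T ⇒ Y} → x ∊ k′ ∘ y → x ∊ k ∘ y) →
            k ≈ k′

    F-intro : ∀ {T X Y} {f : X ⇒ Y} {x : T ⇒ X} {y : T ⇒ Y} {k : T ⇒ F₀ X} →
              x ∊ k → f ∘ x ≈ y → y ∊ F₁ f ∘ k
    -- The goal is a composite `w ∘ a` because that is what `∊-ext` asks for. Restriction along `q`
    -- is absorbed into `a`, so the goal keeps its shape and eliminations can be nested.
    F-elim  : ∀ {T X Y A Z} {f : X ⇒ Y} {y : T ⇒ Y} {k : T ⇒ F₀ X}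
                {z : T ⇒ Z} {w : A ⇒ F₀ Z} {a : T ⇒ A} →
              y ∊ F₁ f ∘ k →
              (∀ {T′} (q : T′ ⇒ T) {x : T′ ⇒ X} → x ∊ k ∘ q → f ∘ x ≈ y ∘ q → z ∘ q ∊ w ∘ a ∘ q) →
              z ∊ w ∘ a

    η-intro : ∀ {T X} {x y : T ⇒ X} → x ≈ y → x ∊ η ∘ y
    η-elim  : ∀ {T X} {x y : T ⇒ X} → x ∊ η ∘ y → x ≈ y

    μ-intro : ∀ {T X} {x : T ⇒ X} {s : T ⇒ F₀ X} {k : T ⇒ F₀ (F₀ X)} → x ∊ s → s ∊ k → x ∊ μ ∘ k
    μ-elim  : ∀ {T X A Z} {x : T ⇒ X} {k : T ⇒ F₀ (F₀ X)}
                {z : T ⇒ Z} {w : A ⇒ F₀ Z} {a : T ⇒ A} →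
              x ∊ μ ∘ k →
              (∀ {T′} (q : T′ ⇒ T) {s : T′ ⇒ F₀ X} → x ∘ q ∊ s → s ∊ k ∘ q → z ∘ q ∊ w ∘ a ∘ q) →
              z ∊ w ∘ a

    t-intro : ∀ {T X Y} {z : T ⇒ X × Y} {w : T ⇒ X × F₀ Y} →
              π₁ ∘ z ≈ π₁ ∘ w → π₂ ∘ z ∊ π₂ ∘ w → z ∊ t ∘ w
    t-elim  : ∀ {T X Y} {z : T ⇒ X × Y} {w : T ⇒ X × F₀ Y} →
              z ∊ t ∘ w → (π₁ ∘ z ≈ π₁ ∘ w) ∧ (π₂ ∘ z ∊ π₂ ∘ w)

  ∊-respˡ : ∀ {T X} {x x′ : T ⇒ X} {k : T ⇒ F₀ X} → x ≈ x′ → x ∊ k → x′ ∊ k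
  ∊-respˡ p = ∊-resp p ≈-refl

  ∊-respʳ : ∀ {T X} {x : T ⇒ X} {k k′ : T ⇒ F₀ X} → k ≈ k′ → x ∊ k → x ∊ k′
  ∊-respʳ = ∊-resp ≈-refl

  ∊-assoc : ∀ {T X A B} {x : T ⇒ X} {k : B ⇒ F₀ X} {f : A ⇒ B} {a : T ⇒ A} →
            x ∊ (k ∘ f) ∘ a → x ∊ k ∘ f ∘ a
  ∊-assoc = ∊-respʳ assoc

  ∊-assoc⁻ : ∀ {T X A B} {x : T ⇒ X} {k : B ⇒ F₀ X} {f : A ⇒ B} {a : T ⇒ A} →
             x ∊ k ∘ f ∘ a → x ∊ (k ∘ f) ∘ a
  ∊-assoc⁻ = ∊-respʳ (≈-sym assoc)

  -- Elements of Kleisli composites and of the costrength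

  bind-intro : ∀ {T X Y A} {g : X ⇒ F₀ Y} {f : A ⇒ F₀ X} {x : T ⇒ X} {y : T ⇒ Y} {a : T ⇒ A} →
               x ∊ f ∘ a → y ∊ g ∘ x → y ∊ (μ ∘ F₁ g ∘ f) ∘ a
  bind-intro m n = ∊-assoc⁻ (μ-intro n (∊-assoc⁻ (F-intro m ≈-refl)))

  -- Unfolding `μ` gives a set `s`, and unfolding `F₁ g` gives an `x` with `g ∘ x ≈ s`, each after
  -- its own restriction. The continuation sees only the composite restriction and the witness `x`,
  -- as in a composition of relations.
  bind-elim : ∀ {T X Y A B Z} {g : X ⇒ F₀ Y} {f : A ⇒ F₀ X} {y : T ⇒ Y} {a : T ⇒ A}
                {z : T ⇒ Z} {w : B ⇒ F₀ Z} {b : T ⇒ B} →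
              y ∊ (μ ∘ F₁ g ∘ f) ∘ a →
              (∀ {T′} (q : T′ ⇒ T) {x : T′ ⇒ X} → x ∊ f ∘ a ∘ q → y ∘ q ∊ g ∘ x → z ∘ q ∊ w ∘ b ∘ q) →
              z ∊ w ∘ b
  bind-elim m H = μ-elim (∊-assoc m) λ q y∊s s∊ →
    F-elim (∊-respʳ (≈-trans assoc assoc) s∊) λ q′ x∊ gx≈s →
      ∊-resp (≈-sym assoc) (∘-resp-≈ʳ (≈-sym assoc))
        (H (q ∘ q′) (∊-respʳ (≈-trans assoc (∘-resp-≈ʳ assoc)) x∊)
           (∊-resp assoc (≈-sym gx≈s) (∊-∘ q′ y∊s)))

  swap² : ∀ {A B} → swap {A} {B} ∘ swap ≈ id
  swap² = ×-ext (≈-trans (pullˡ project₁) (≈-trans project₂ (≈-sym identityʳ)))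
                (≈-trans (pullˡ project₂) (≈-trans project₁ (≈-sym identityʳ)))

  t′-intro : ∀ {T X Y} {z : T ⇒ X × Y} {w : T ⇒ F₀ X × Y} →
             π₁ ∘ z ∊ π₁ ∘ w → π₂ ∘ z ≈ π₂ ∘ w → z ∊ t′ ∘ w
  t′-intro m p = ∊-respʳ (≈-sym (≈-trans assoc (∘-resp-≈ʳ assoc)))
    -- The preimage of `z` under `swap` is its own swap.
    (F-intro {x = swap ∘ _}
      (t-intro (≈-trans (pullˡ project₁) (≈-trans p (≈-sym (pullˡ project₁))))
               (∊-resp (≈-sym (pullˡ project₂)) (≈-sym (pullˡ project₂)) m))
      (≈-trans (pullˡ swap²) identityˡ))

  -- In continuation form, unlike `t-elim`, since unfolding `F₁ swap` requires a restriction.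
  t′-elim : ∀ {T X Y A Z} {z : T ⇒ X × Y} {w : T ⇒ F₀ X × Y}
              {x : T ⇒ Z} {k : A ⇒ F₀ Z} {a : T ⇒ A} → z ∊ t′ ∘ w →
            (∀ {T′} (q : T′ ⇒ T) → π₁ ∘ z ∘ q ∊ π₁ ∘ w ∘ q → π₂ ∘ z ∘ q ≈ π₂ ∘ w ∘ q →
               x ∘ q ∊ k ∘ a ∘ q) →
            x ∊ k ∘ a
  t′-elim {z = z} {w} m H = F-elim (∊-respʳ (≈-trans assoc (∘-resp-≈ʳ assoc)) m) λ q {v} v∊ e →
    let (p , n) = t-elim (∊-respʳ (≈-trans assoc (∘-resp-≈ʳ assoc)) v∊) in
    H q (∊-resp (≈-trans (≈-sym (pullˡ project₁)) (∘-resp-≈ʳ e)) (pullˡ project₂) n)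
        (≈-trans (∘-resp-≈ʳ (≈-sym e)) (≈-trans (pullˡ project₂) (≈-trans p (pullˡ project₁))))

  -- The monad laws

  isMonad : IsMonad M
  isMonad = record
    { F-resp-≈ = F-resp
    ; F-identity = ∊-ext
        (λ m → F-elim m λ q n p →
          ∊-resp (≈-trans (≈-sym identityˡ) p) (≈-sym identityˡ) n)
        (λ m → F-intro (∊-respʳ identityˡ m) identityˡ)
    ; homomorphism = ∊-ext
        (λ m → F-elim m λ q n p →
          ∊-assoc⁻ (F-intro (F-intro n ≈-refl) (≈-trans (≈-sym assoc) p)))
        (λ m → F-elim (∊-assoc m) λ q n p → F-elim (∊-assoc n) λ q′ n′ p′ →
          F-intro n′ (≈-trans assoc (≈-trans (∘-resp-≈ʳ p′) (≈-trans (≈-sym assoc) (∘-resp-≈ˡ p)))))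
    ; η-natural = ∊-ext
        (λ m → ∊-assoc⁻ (F-intro (η-intro ≈-refl) (≈-sym (η-elim (∊-assoc m)))))
        (λ m → F-elim (∊-assoc m) λ q n p →
          ∊-assoc⁻ (η-intro (≈-trans (≈-sym p) (∘-resp-≈ʳ (η-elim (∊-assoc n))))))
    ; μ-natural = ∊-ext
        (λ m → μ-elim (∊-assoc m) λ q x∊s s∊ →
          F-elim (∊-assoc s∊) λ q′ r∊ p →
          -- Here `s` is the direct image under `f` of a member `r` of the given family, so `x` has
          -- a preimage in `r`.
          F-elim (∊-respʳ (≈-sym p) (∊-∘ q′ x∊s)) λ q″ y∊ p′ →
          ∊-assoc⁻ (F-intro (μ-intro y∊ (∊-∘ q″ r∊)) p′))
        (λ m → F-elim (∊-assoc m) λ q x∊ p →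
          μ-elim (∊-assoc x∊) λ q′ x∊s s∊ →
          ∊-assoc⁻ (μ-intro (F-intro x∊s (≈-trans (≈-sym assoc) (∘-resp-≈ˡ p)))
                            (F-intro s∊ ≈-refl)))
    ; μ-assoc = ∊-ext
        (λ m → μ-elim (∊-assoc m) λ q x∊s s∊ →
          F-elim (∊-assoc s∊) λ q′ r∊ p →
          μ-elim (∊-respʳ (≈-sym p) (∊-∘ q′ x∊s)) λ q″ x∊u u∊ →
          ∊-assoc⁻ (μ-intro x∊u (μ-intro u∊ (∊-∘ q″ r∊))))
        (λ m → μ-elim (∊-assoc m) λ q x∊s s∊ →
          μ-elim (∊-assoc s∊) λ q′ s∊u u∊ →
          ∊-assoc⁻ (μ-intro (μ-intro (∊-∘ q′ x∊s) s∊u) (F-intro u∊ ≈-refl)))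
    ; μ-identityˡ = ∊-ext
        (λ m → μ-elim (∊-assoc m) λ q x∊s s∊ →
          F-elim (∊-assoc s∊) λ q′ r∊ p →
          -- Here `s` is the singleton of an element `r` of the given set, which forces `x` to equal
          -- `r`.
          ∊-resp (≈-sym (η-elim (∊-respʳ (≈-sym p) (∊-∘ q′ x∊s)))) (≈-sym identityˡ) r∊)
        (λ m → ∊-assoc⁻ (μ-intro (η-intro ≈-refl) (F-intro (∊-respʳ identityˡ m) ≈-refl)))
    ; μ-identityʳ = ∊-ext
        (λ m → μ-elim (∊-assoc m) λ q x∊s s∊ →
          ∊-respʳ (≈-trans (η-elim (∊-assoc s∊)) (≈-sym identityˡ)) x∊s)
        (λ m → ∊-assoc⁻ (μ-intro (∊-respʳ identityˡ m) (η-intro ≈-refl)))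
    }
    where
      -- `F₁` carries no congruence of its own: images are chosen, perhaps differently for equal
      -- morphisms. The elements of the two direct images nevertheless have the same witnesses.
      F-mono : ∀ {T X Y} {f g : X ⇒ Y} {x : T ⇒ Y} {y : T ⇒ F₀ X} →
               f ≈ g → x ∊ F₁ f ∘ y → x ∊ F₁ g ∘ y
      F-mono p m = F-elim m λ q n e → F-intro n (≈-trans (∘-resp-≈ˡ (≈-sym p)) e)
      F-resp : ∀ {X Y} {f g : X ⇒ Y} → f ≈ g → F₁ f ≈ F₁ g
      F-resp p = ∊-ext (F-mono p) (F-mono (≈-sym p))

  -- The strength laws

  isStrength : IsStrength M
  isStrength = record
    { t-natural = ∊-ext
        (λ m → let (p , n) = t-elim (∊-assoc m) in
          F-elim (∊-respʳ (≈-trans (pullˡ project₂) assoc) n) λ q b∊ e →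
          -- The witness is the pair of the first component of the argument and the element `b` that
          -- `g` sends to the second component.
          ∊-assoc⁻ (F-intro
            (t-intro project₁ (∊-resp (≈-sym project₂) assoc b∊))
            (≈-trans ⁂∘⟨⟩ (⟨⟩-unique
              (≈-trans (≈-sym assoc) (≈-trans (∘-resp-≈ˡ (≈-trans p (≈-trans (pullˡ project₁) assoc)))
                (≈-trans assoc (∘-resp-≈ʳ assoc))))
              (≈-trans (≈-sym assoc) (≈-sym e))))))
        (λ m → F-elim (∊-assoc m) λ q b∊ e →
          let (p , n) = t-elim (∊-assoc b∊) in
          ∊-assoc⁻ (t-intro
            (≈-trans (∘-resp-≈ʳ (≈-sym e)) (≈-trans (pullˡ project₁) (≈-trans (pullʳ p)
              (≈-sym (≈-trans (pullˡ project₁) assoc)))))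
            (∊-respʳ (≈-sym (≈-trans (pullˡ project₂) assoc))
              (F-intro n (≈-trans (≈-sym assoc) (≈-trans (∘-resp-≈ˡ (≈-sym project₂))
                (≈-trans assoc (∘-resp-≈ʳ e))))))))
    ; t-unit = ∊-ext
        (λ m → F-elim (∊-assoc m) λ q b∊ e →
          ∊-respˡ e (proj₂ (t-elim (∊-assoc b∊))))
        (λ m → ∊-assoc⁻ (F-intro
          (t-intro (≈-trans (≈-sym (!-unique _)) (!-unique _)) (∊-respˡ (≈-sym project₂) m))
          -- This fixes the witness as the pair of `!` and the given element; the constraint in `⊤`
          -- would leave the first component undetermined.
          (project₂ {f = !})))
    ; t-assoc = ∊-ext
        (λ m → F-elim (∊-assoc m) λ q b∊ e →
          let (p , n) = t-elim (∊-assoc b∊) in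
          ∊-respˡ e (∊-assoc⁻ (t-intro
            (≈-trans (≈-trans (pullˡ project₁) assoc) (≈-trans (∘-resp-≈ʳ p) (≈-sym π₁-nested)))
            (∊-resp (≈-sym (pullˡ project₂)) (≈-sym π₂-nested) (t-intro
              (≈-trans (≈-trans (pullˡ project₁) assoc)
                (≈-trans (∘-resp-≈ʳ p) (≈-sym (≈-trans (pullˡ project₁) assoc))))
              (∊-resp (≈-sym (pullˡ project₂)) (≈-sym (pullˡ project₂)) n))))))
        (λ m →
          let (p , n)   = t-elim (∊-assoc m)
              (p′ , n′) = t-elim (∊-respʳ π₂-nested n) in
          ∊-assoc⁻ (F-intro
            -- With `z` for the given element, the witness is the rebracketed triple `⟨ ⟨ π₁ ∘ z ,
            -- π₁ ∘ π₂ ∘ z ⟩ , π₂ ∘ π₂ ∘ z ⟩`.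
            (t-intro
              (≈-trans project₁ (⟨⟩-unique (≈-sym (≈-trans p π₁-nested))
                (≈-sym (≈-trans p′ (≈-trans (pullˡ project₁) assoc)))))
              (∊-resp (≈-sym project₂) (pullˡ project₂) n′))
            (≈-trans ⟨⟩∘ (⟨⟩-unique
              (≈-sym (≈-trans (pullʳ project₁) project₁))
              (≈-sym (≈-trans ⟨⟩∘ (⟨⟩-unique
                (≈-sym (≈-trans (pullʳ project₁) project₂)) (≈-sym project₂))))))))
    ; t-η = ∊-ext
        (λ m → let (p , n) = t-elim (∊-assoc m) in
          η-intro (×-ext
            (≈-trans p (≈-trans (pullˡ project₁) (∘-resp-≈ˡ identityˡ)))
            (η-elim (∊-respʳ (≈-trans (pullˡ project₂) assoc) n))))
        (λ m → ∊-assoc⁻ (t-intro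
          (≈-trans (∘-resp-≈ʳ (η-elim m)) (≈-sym (≈-trans (pullˡ project₁) (∘-resp-≈ˡ identityˡ))))
          (∊-respʳ (≈-sym (≈-trans (pullˡ project₂) assoc)) (η-intro (∘-resp-≈ʳ (η-elim m))))))
    ; t-μ = ∊-ext
        (λ m →
          let (p , n) = t-elim (∊-assoc m) in
          μ-elim (∊-respʳ (≈-trans (pullˡ project₂) assoc) n) λ q z₂∊s s∊ →
          -- The right-hand side is the Kleisli composite of `t` with itself. The intermediate
          -- element pairs the first component of the argument with the set `s`.
          bind-intro
            (t-intro project₁ (∊-resp (≈-sym project₂) assoc s∊))
            (t-intro
              (≈-trans (≈-trans (≈-sym assoc) (≈-trans (∘-resp-≈ˡ (≈-trans p
                  (≈-trans (pullˡ project₁) (∘-resp-≈ˡ identityˡ)))) assoc)) (≈-sym project₁))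
              (∊-resp assoc (≈-sym project₂) z₂∊s)))
        (λ m → bind-elim m λ q x∊ z∊ →
          let (p , n)   = t-elim x∊
              (p′ , n′) = t-elim z∊ in
          ∊-assoc⁻ (t-intro
            (≈-trans p′ (≈-trans p (≈-sym (≈-trans (pullˡ project₁) (∘-resp-≈ˡ identityˡ)))))
            (∊-respʳ (≈-sym (≈-trans (pullˡ project₂) assoc)) (μ-intro n′ n))))
    }
    where
      π₁-nested : ∀ {T X Y Z} {w : T ⇒ (X × Y) × F₀ Z} →
                  π₁ ∘ ((id ⁂ t) ∘ assocʳ) ∘ w ≈ π₁ ∘ π₁ ∘ w
      π₁-nested = ≈-trans (∘-resp-≈ʳ assoc)
        (≈-trans (pullˡ project₁) (≈-trans assoc (≈-trans identityˡ (≈-trans (pullˡ project₁) assoc))))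
      π₂-nested : ∀ {T X Y Z} {w : T ⇒ (X × Y) × F₀ Z} →
                  π₂ ∘ ((id ⁂ t) ∘ assocʳ) ∘ w ≈ t ∘ ⟨ π₂ ∘ π₁ , π₂ ⟩ ∘ w
      π₂-nested = ≈-trans (∘-resp-≈ʳ assoc)
        (≈-trans (pullˡ project₂) (≈-trans assoc (∘-resp-≈ʳ (pullˡ project₂))))

  -- Commutativity

  -- Both composites are the product (k , l) ↦ {(x , y) | x ∊ k and y ∊ l}.
  isCommutativeMonad : IsCommutativeMonad M
  isCommutativeMonad = record
    { isMonad = isMonad
    ; isStrength = isStrength
    ; commutative = ∊-ext
        (λ m → right-intro (left₁ m) (left₂ m))
        (λ m → left-intro (right₁ m) (right₂ m))
    }
    where
      -- `t` keeps the set `π₁ ∘ w` in the intermediate pair and picks an element of `π₂ ∘ w`; `t′`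
      -- then picks an element of the set that was kept.
      left₁ : ∀ {T X Y} {z : T ⇒ X × Y} {w : T ⇒ F₀ X × F₀ Y} →
              z ∊ (μ ∘ F₁ t′ ∘ t) ∘ w → π₁ ∘ z ∊ π₁ ∘ w
      left₁ m = bind-elim m λ q p∊ z∊ → t′-elim z∊ λ q′ n _ →
        ∊-resp (≈-trans (∘-resp-≈ʳ assoc) (≈-sym (≈-trans assoc assoc)))
          (≈-trans (≈-sym assoc) (≈-trans (∘-resp-≈ˡ (proj₁ (t-elim p∊))) assoc)) n
      left₂ : ∀ {T X Y} {z : T ⇒ X × Y} {w : T ⇒ F₀ X × F₀ Y} →
              z ∊ (μ ∘ F₁ t′ ∘ t) ∘ w → π₂ ∘ z ∊ π₂ ∘ w
      left₂ m = bind-elim m λ q p∊ z∊ → t′-elim z∊ λ q′ _ e →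
        ∊-resp (≈-trans assoc (≈-trans (≈-sym e) (≈-trans (≈-sym assoc) (∘-resp-≈ˡ (≈-sym assoc)))))
          assoc (∊-∘ q′ (proj₂ (t-elim p∊)))
      left-intro : ∀ {T X Y} {z : T ⇒ X × Y} {w : T ⇒ F₀ X × F₀ Y} →
                   π₁ ∘ z ∊ π₁ ∘ w → π₂ ∘ z ∊ π₂ ∘ w → z ∊ (μ ∘ F₁ t′ ∘ t) ∘ w
      left-intro m n = bind-intro
        (t-intro project₁ (∊-respˡ (≈-sym project₂) n))
        (t′-intro (∊-respʳ (≈-sym project₁) m) (≈-sym project₂))
      -- In the other order, `t′` picks the first component and keeps the set `π₂ ∘ w`, from which
      -- `t` picks the second.
      right₁ : ∀ {T X Y} {z : T ⇒ X × Y} {w : T ⇒ F₀ X × F₀ Y} →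
               z ∊ (μ ∘ F₁ t ∘ t′) ∘ w → π₁ ∘ z ∊ π₁ ∘ w
      right₁ m = bind-elim m λ q p∊ z∊ → t′-elim p∊ λ q′ n _ →
        ∊-respˡ (≈-trans (≈-sym assoc)
          (∘-resp-≈ˡ (≈-trans (≈-sym (proj₁ (t-elim z∊))) (≈-sym assoc)))) n
      right₂ : ∀ {T X Y} {z : T ⇒ X × Y} {w : T ⇒ F₀ X × F₀ Y} →
               z ∊ (μ ∘ F₁ t ∘ t′) ∘ w → π₂ ∘ z ∊ π₂ ∘ w
      right₂ m = bind-elim m λ q p∊ z∊ → t′-elim p∊ λ q′ _ e →
        ∊-resp (∘-resp-≈ˡ (≈-sym assoc)) (≈-trans assoc e) (∊-∘ q′ (proj₂ (t-elim z∊)))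
      right-intro : ∀ {T X Y} {z : T ⇒ X × Y} {w : T ⇒ F₀ X × F₀ Y} →
                    π₁ ∘ z ∊ π₁ ∘ w → π₂ ∘ z ∊ π₂ ∘ w → z ∊ (μ ∘ F₁ t ∘ t′) ∘ w
      right-intro m n = bind-intro
        (t′-intro (∊-respˡ (≈-sym project₁) m) project₂)
        (t-intro (≈-sym project₁) (∊-respʳ (≈-sym project₂) n))

-- Power objects satisfy the membership rules

module _ {o ℓ e} (𝒯 : Topos o ℓ e) where
  open Topos 𝒯
  open Category category
  open FinitelyComplete finitelyComplete
  open ToposProperties 𝒯
  open Subobject
  open Subobjects category

  private
    module P = StrongMonadData powerMonad

    infix 4 _∊_
    _∊_ : ∀ {T X} → T ⇒ X → T ⇒ 𝒫 X → Set (ℓ ⊔ e)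
    _∊_ {X = X} x k = ⟨ x , k ⟩ ∈ ∈[ X ]

    ∊-resp : ∀ {T X} {x x′ : T ⇒ X} {k k′ : T ⇒ 𝒫 X} → x ≈ x′ → k ≈ k′ → x ∊ k → x′ ∊ k′
    ∊-resp {X = X} p q = ∈-resp {S = ∈[ X ]} (⟨⟩-cong p q)

    -- Membership is factorisation through a mono, and a cover factors through a preimage of that
    -- mono only if the identity does. This discharges the covers in `F-elim` and `μ-elim`.
    ∊-local : ∀ {T T′ X A} {x : T ⇒ X} {k : A ⇒ 𝒫 X} {a : T ⇒ A} {q : T′ ⇒ T} →
              Cover q → x ∘ q ∊ k ∘ a ∘ q → x ∊ k ∘ a
    ∊-local {X = X} cover m = cover-elim₂ ∈[ X ] cover (∊-resp ≈-refl (≈-sym assoc) m)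

    ∊-elements : ∀ {T X} (h : T ⇒ dom ∈[ X ]) → π₁ ∘ arr ∈[ X ] ∘ h ∊ π₂ ∘ arr ∈[ X ] ∘ h
    ∊-elements h = h , ≈-sym η-×

    pair-inj₁ : ∀ {A B Z} {f f′ : Z ⇒ A} {g g′ : Z ⇒ B} → ⟨ f , g ⟩ ≈ ⟨ f′ , g′ ⟩ → f ≈ f′
    pair-inj₁ p = ≈-trans (≈-sym project₁) (≈-trans (∘-resp-≈ʳ p) project₁)

    pair-inj₂ : ∀ {A B Z} {f f′ : Z ⇒ A} {g g′ : Z ⇒ B} → ⟨ f , g ⟩ ≈ ⟨ f′ , g′ ⟩ → g ≈ g′
    pair-inj₂ p = ≈-trans (≈-sym project₂) (≈-trans (∘-resp-≈ʳ p) project₂)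

    -- The same term as in `powerMonad`, so that `P.F₁ f` unfolds to `ξ (imageRel f)`; likewise
    -- `strengthRel` for `P.t`.
    imageRel : ∀ {X Y} → X ⇒ Y → Relation Y (𝒫 X)
    imageRel {X} f = monoPart ((f ⁂ id) ∘ arr ∈[ X ])

    imageRel-intro : ∀ {T X Y} (f : X ⇒ Y) {x : T ⇒ X} {y : T ⇒ Y} {k : T ⇒ 𝒫 X} →
                     x ∊ k → f ∘ x ≈ y → ⟨ y , k ⟩ ∈ imageRel f
    imageRel-intro f (h , p) fx≈y = ∈-resp {S = imageRel f}
      (≈-trans (pullʳ p) (≈-trans ⁂∘⟨⟩ (⟨⟩-cong fx≈y identityˡ)))
      (monoPart-intro _ h)

    -- An element of an image lifts along the epi part only on a cover. The lift lands in the domain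
    -- of `∈[ X ]`, and its first projection is the witness.
    imageRel-elim : ∀ {T X Y} (f : X ⇒ Y) {y : T ⇒ Y} {k : T ⇒ 𝒫 X} → ⟨ y , k ⟩ ∈ imageRel f →
                    Σ[ T′ ∈ Obj ] Σ[ q ∈ T′ ⇒ T ] Cover q ∧
                      (Σ[ x ∈ T′ ⇒ X ] (x ∊ k ∘ q) ∧ (f ∘ x ≈ y ∘ q))
    imageRel-elim {X = X} f {y} {k} m with monoPart-elim _ m
    ... | (T′ , q , cover , h , p) =
      T′ , q , cover , π₁ ∘ arr ∈[ X ] ∘ h ,
      ∊-resp ≈-refl (≈-trans (≈-sym (≈-trans assoc identityˡ)) (pair-inj₂ p′)) (∊-elements h) ,
      ≈-trans (≈-sym assoc) (pair-inj₁ p′)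
      where
        p′ : ⟨ (f ∘ π₁) ∘ arr ∈[ X ] ∘ h , (id ∘ π₂) ∘ arr ∈[ X ] ∘ h ⟩ ≈ ⟨ y ∘ q , k ∘ q ⟩
        p′ = ≈-trans (≈-sym (≈-trans assoc ⟨⟩∘)) (≈-trans p ⟨⟩∘)

    strengthRel : ∀ X Y → Relation (X × Y) (X × 𝒫 Y)
    strengthRel X Y = monoPart (⟨ id {X} ⁂ π₁ , id ⁂ π₂ ⟩ ∘ (id ⁂ arr ∈[ Y ]))

    -- Both halves share the component `π₁ ∘ h`, the source of the equation in `strengthRel-elim`.
    strengthRel-elements : ∀ {T X Y} (h : T ⇒ X × dom ∈[ Y ]) →
      (⟨ id {X} ⁂ π₁ , id ⁂ π₂ ⟩ ∘ (id ⁂ arr ∈[ Y ])) ∘ h ≈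
      ⟨ ⟨ π₁ ∘ h , π₁ ∘ arr ∈[ Y ] ∘ π₂ ∘ h ⟩ , ⟨ π₁ ∘ h , π₂ ∘ arr ∈[ Y ] ∘ π₂ ∘ h ⟩ ⟩
    strengthRel-elements {X = X} {Y} h =
      ≈-trans (pullʳ ⟨⟩∘) (≈-trans ⟨⟩∘ (⟨⟩-cong (component π₁) (component π₂)))
      where
        component : ∀ {B} (π : Y × 𝒫 Y ⇒ B) →
                    (id ⁂ π) ∘ ⟨ (id ∘ π₁) ∘ h , (arr ∈[ Y ] ∘ π₂) ∘ h ⟩ ≈
                    ⟨ π₁ ∘ h , π ∘ arr ∈[ Y ] ∘ π₂ ∘ h ⟩
        component π = ≈-trans ⁂∘⟨⟩
          (⟨⟩-cong (≈-trans identityˡ (≈-trans assoc identityˡ)) (∘-resp-≈ʳ assoc))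

    strengthRel-intro : ∀ {T X Y} {z : T ⇒ X × Y} {w : T ⇒ X × 𝒫 Y} →
                        π₁ ∘ z ≈ π₁ ∘ w → π₂ ∘ z ∊ π₂ ∘ w → ⟨ z , w ⟩ ∈ strengthRel X Y
    strengthRel-intro {X = X} {Y} {z} {w} p (h , r) = ∈-resp {S = strengthRel X Y}
      (≈-trans (strengthRel-elements _) (⟨⟩-cong
        (⟨⟩-unique (≈-trans p (≈-sym project₁))
          (≈-sym (≈-trans (∘-resp-≈ʳ r′) project₁)))
        (⟨⟩-unique (≈-sym project₁)
          (≈-sym (≈-trans (∘-resp-≈ʳ r′) project₂)))))
      (monoPart-intro _ ⟨ π₁ ∘ w , h ⟩)
      where
        r′ : arr ∈[ Y ] ∘ π₂ ∘ ⟨ π₁ ∘ w , h ⟩ ≈ ⟨ π₂ ∘ z , π₂ ∘ w ⟩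
        r′ = ≈-trans (∘-resp-≈ʳ project₂) r

    -- No cover survives in the conclusion: the equation descends because covers are epi, the
    -- membership because covers are orthogonal to monos.
    strengthRel-elim : ∀ {T X Y} {z : T ⇒ X × Y} {w : T ⇒ X × 𝒫 Y} →
                       ⟨ z , w ⟩ ∈ strengthRel X Y → (π₁ ∘ z ≈ π₁ ∘ w) ∧ (π₂ ∘ z ∊ π₂ ∘ w)
    strengthRel-elim {Y = Y} {z} {w} m with monoPart-elim _ m
    ... | (T′ , q , cover , h , p) =
      cover⇒epi cover _ _ (≈-trans assoc
        (≈-trans (≈-sym (component₁ z≈)) (≈-trans (component₁ w≈) (≈-sym assoc)))) ,
      cover-elim₂ ∈[ Y ] cover (∊-resp
        (≈-trans (component₂ z≈) (≈-sym assoc)) (≈-trans (component₂ w≈) (≈-sym assoc))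
        (∊-elements (π₂ ∘ h)))
      where
        p′ : ⟨ ⟨ π₁ ∘ h , π₁ ∘ arr ∈[ Y ] ∘ π₂ ∘ h ⟩ , ⟨ π₁ ∘ h , π₂ ∘ arr ∈[ Y ] ∘ π₂ ∘ h ⟩ ⟩
             ≈ ⟨ z ∘ q , w ∘ q ⟩
        p′ = ≈-trans (≈-sym (strengthRel-elements h)) (≈-trans p ⟨⟩∘)
        z≈ = pair-inj₁ p′
        w≈ = pair-inj₂ p′
        component₁ : ∀ {A B Z} {f : Z ⇒ A} {g : Z ⇒ B} {u : Z ⇒ A × B} → ⟨ f , g ⟩ ≈ u → f ≈ π₁ ∘ u
        component₁ r = ≈-trans (≈-sym project₁) (∘-resp-≈ʳ r)
        component₂ : ∀ {A B Z} {f : Z ⇒ A} {g : Z ⇒ B} {u : Z ⇒ A × B} → ⟨ f , g ⟩ ≈ u → g ≈ π₂ ∘ u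
        component₂ r = ≈-trans (≈-sym project₂) (∘-resp-≈ʳ r)

    F-elim : ∀ {T X Y A Z} {f : X ⇒ Y} {y : T ⇒ Y} {k : T ⇒ 𝒫 X}
               {z : T ⇒ Z} {w : A ⇒ 𝒫 Z} {a : T ⇒ A} →
             y ∊ P.F₁ f ∘ k →
             (∀ {T′} (q : T′ ⇒ T) {x : T′ ⇒ X} → x ∊ k ∘ q → f ∘ x ≈ y ∘ q → z ∘ q ∊ w ∘ a ∘ q) →
             z ∊ w ∘ a
    F-elim {T} {X} {f = f} {y} {k} {z} {w} {a} m H = use (imageRel-elim f (ξ-elim (imageRel f) m))
      where
        use : Σ[ T′ ∈ Obj ] Σ[ q ∈ T′ ⇒ T ] Cover q ∧
                (Σ[ x ∈ T′ ⇒ X ] (x ∊ k ∘ q) ∧ (f ∘ x ≈ y ∘ q)) → z ∊ w ∘ a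
        use (_ , q , cover , _ , x∊k , p) = ∊-local {x = z} {w} {a} cover (H q x∊k p)

    μ-elim : ∀ {T X A Z} {x : T ⇒ X} {k : T ⇒ 𝒫 (𝒫 X)}
               {z : T ⇒ Z} {w : A ⇒ 𝒫 Z} {a : T ⇒ A} →
             x ∊ P.μ ∘ k →
             (∀ {T′} (q : T′ ⇒ T) {s : T′ ⇒ 𝒫 X} → x ∘ q ∊ s → s ∊ k ∘ q → z ∘ q ∊ w ∘ a ∘ q) →
             z ∊ w ∘ a
    μ-elim {T} {X} {x = x} {k} {z} {w} {a} m H =
      use (⨾-elim ∈[ X ] ∈[ 𝒫 X ] (ξ-elim (∈[ X ] ⨾ ∈[ 𝒫 X ]) m))
      where
        use : Σ[ T′ ∈ Obj ] Σ[ q ∈ T′ ⇒ T ] Cover q ∧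
                (Σ[ s ∈ T′ ⇒ 𝒫 X ] (x ∘ q ∊ s) ∧ (s ∊ k ∘ q)) → z ∊ w ∘ a
        use (_ , q , cover , _ , x∊s , s∊k) = ∊-local {x = z} {w} {a} cover (H q x∊s s∊k)

  powerMembership : Membership powerMonad (ℓ ⊔ e)
  powerMembership = record
    { _∊_ = _∊_
    ; ∊-resp = ∊-resp
    ; ∊-∘ = λ {_} {_} {X} → restrict ∈[ X ]
    ; ∊-ext = 𝒫-ext
    ; F-intro = λ {_} {_} {_} {f} m p → ξ-intro (imageRel f) (imageRel-intro f m p)
    ; F-elim = λ {_} {_} {_} {_} {_} {f} {y} {k} {z} {w} {a} → F-elim {f = f} {y} {k} {z} {w} {a}
    ; η-intro = λ p → ξ-intro Δ (Δ-intro p)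
    ; η-elim = λ m → Δ-elim (ξ-elim Δ m)
    ; μ-intro = λ {_} {X} m n → ξ-intro (∈[ X ] ⨾ ∈[ 𝒫 X ]) (⨾-intro ∈[ X ] ∈[ 𝒫 X ] m n)
    ; μ-elim = λ {_} {_} {_} {_} {x} {k} {z} {w} {a} → μ-elim {x = x} {k} {z} {w} {a}
    ; t-intro = λ {_} {X} {Y} p m → ξ-intro (strengthRel X Y) (strengthRel-intro p m)
    ; t-elim = λ {_} {X} {Y} m → strengthRel-elim (ξ-elim (strengthRel X Y) m)
    }

  open Membership powerMembership using (bind-intro; bind-elim; η-intro; η-elim)

  opaque
    -- Can be opaque because Kleisli identities and composites come from the data; only the truth of
    -- the laws matters below.
    powerCommutative : IsCommutativeMonad powerMonad
    powerCommutative = Membership.isCommutativeMonad powerMembership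

  -- Relations as Kleisli morphisms

  open IsCommutativeMonad powerCommutative using (isMonad)

  -- `ξ` alone would give `Y ⇒ 𝒫 X`; swapping first makes a relation from `X` to `Y` a Kleisli
  -- morphism in the same direction.
  name : ∀ {X Y} → Relation X Y → X ⇒ 𝒫 Y
  name r = ξ (preimage swap r)

  -- The swap is built into the map, which sends (x, y) to (y, k x).
  graph : ∀ {X Y} → X ⇒ 𝒫 Y → Relation X Y
  graph {Y = Y} k = preimage ⟨ π₂ , k ∘ π₁ ⟩ ∈[ Y ]

  module _ {X Y T} {x : T ⇒ X} {y : T ⇒ Y} where
    private
      swap⟨⟩ : swap ∘ ⟨ y , x ⟩ ≈ ⟨ x , y ⟩
      swap⟨⟩ = ≈-trans ⟨⟩∘ (⟨⟩-cong project₂ project₁)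
      graph⟨⟩ : ∀ {k : X ⇒ 𝒫 Y} → ⟨ π₂ , k ∘ π₁ ⟩ ∘ ⟨ x , y ⟩ ≈ ⟨ y , k ∘ x ⟩
      graph⟨⟩ = ≈-trans ⟨⟩∘ (⟨⟩-cong project₂ (pullʳ project₁))

    name-intro : (r : Relation X Y) → ⟨ x , y ⟩ ∈ r → y ∊ name r ∘ x
    name-intro r m = ξ-intro (preimage swap r)
      (preimage-intro swap r (∈-resp {S = r} (≈-sym swap⟨⟩) m))

    name-elim : (r : Relation X Y) → y ∊ name r ∘ x → ⟨ x , y ⟩ ∈ r
    name-elim r m = ∈-resp {S = r} swap⟨⟩ (preimage-elim swap r (ξ-elim (preimage swap r) m))

    graph-intro : (k : X ⇒ 𝒫 Y) → y ∊ k ∘ x → ⟨ x , y ⟩ ∈ graph k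
    graph-intro k m = preimage-intro _ ∈[ Y ] (∈-resp {S = ∈[ Y ]} (≈-sym graph⟨⟩) m)

    graph-elim : (k : X ⇒ 𝒫 Y) → ⟨ x , y ⟩ ∈ graph k → y ∊ k ∘ x
    graph-elim k m = ∈-resp {S = ∈[ Y ]} graph⟨⟩ (preimage-elim _ ∈[ Y ] m)

  graph-mono : ∀ {X Y} {k k′ : X ⇒ 𝒫 Y} → k ≈ k′ → graph k ≤ graph k′
  graph-mono {k = k} {k′} p = ≤-fromElements (graph k) (graph k′) λ m →
    graph-intro k′ (∊-resp ≈-refl (∘-resp-≈ˡ p) (graph-elim k m))

  graph-resp : ∀ {X Y} {k k′ : X ⇒ 𝒫 Y} → k ≈ k′ → graph k ≃ graph k′
  graph-resp p = graph-mono p , graph-mono (≈-sym p)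

  name-resp : ∀ {X Y} {r s : Relation X Y} → r ≃ s → name r ≈ name s
  name-resp {r = r} {s} (p , p′) = 𝒫-ext
    (λ m → name-intro s (≤-elim {R = r} {S = s} p (name-elim r m)))
    (λ m → name-intro r (≤-elim {R = s} {S = r} p′ (name-elim s m)))

  name∘graph : ∀ {X Y} (k : X ⇒ 𝒫 Y) → name (graph k) ≈ k
  name∘graph k = 𝒫-ext
    (λ m → graph-elim k (name-elim (graph k) m))
    (λ m → name-intro (graph k) (graph-intro k m))

  graph∘name : ∀ {X Y} (r : Relation X Y) → graph (name r) ≃ r
  graph∘name r =
    ≤-fromElements (graph (name r)) r (λ m → name-elim r (graph-elim (name r) m)) ,
    ≤-fromElements r (graph (name r)) (λ m → graph-intro (name r) (name-intro r m))

  -- `η` classifies the diagonal unswapped; the two agree by symmetry of equality.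
  name-Δ : ∀ {X} → name (Δ {X}) ≈ P.η
  name-Δ = 𝒫-ext
    (λ m → η-intro (≈-sym (Δ-elim (name-elim Δ m))))
    (λ m → name-intro Δ (Δ-intro (≈-sym (η-elim m))))

  -- The intermediate element of `r ⨾ s` is the one through which the Kleisli composite passes, so a
  -- witness for either side serves for the other.
  name-⨾ : ∀ {X Y Z} (r : Relation X Y) (s : Relation Y Z) →
           name (r ⨾ s) ≈ P.μ ∘ P.F₁ (name s) ∘ name r
  name-⨾ r s = 𝒫-ext
    (λ m → let (_ , q , cover , _ , a , b) = ⨾-elim r s (name-elim (r ⨾ s) m) in
      ∊-local cover (bind-intro (name-intro r a) (name-intro s b)))
    (λ m → bind-elim m λ q y∊ z∊ →
      name-intro (r ⨾ s) (⨾-intro r s (name-elim r y∊) (name-elim s z∊)))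

  -- The isomorphism of categories

  private
    module Rel = Category Rel
    module Kl = Category (Kleisli powerMonad isMonad)

  graph-η : ∀ {X} → graph (P.η {X}) ≃ Δ
  graph-η = Rel.≈-trans {i = graph P.η} {graph (name Δ)} {Δ}
    (graph-resp (≈-sym name-Δ)) (graph∘name Δ)

  -- As `graph` inverts `name`, it inherits compatibility with composition from `name-⨾`, without
  -- any elements.
  graph-∘ : ∀ {X Y Z} (f : X ⇒ 𝒫 Y) (g : Y ⇒ 𝒫 Z) → graph (g Kl.∘ f) ≃ graph f ⨾ graph g
  graph-∘ f g = Rel.≈-trans
    {i = graph (g Kl.∘ f)} {graph (name (graph f ⨾ graph g))} {graph f ⨾ graph g}
    (graph-resp (≈-sym (≈-trans (name-⨾ (graph f) (graph g))
      (Kl.∘-resp-≈ (name∘graph g) (name∘graph f)))))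
    (graph∘name (graph f ⨾ graph g))

  graphF : Functor (Kleisli powerMonad isMonad) Rel
  graphF = record
    { F₀ = λ X → X
    ; F₁ = graph
    ; F-resp-≈ = graph-resp
    ; identity = graph-η
    ; homomorphism = λ {_} {_} {_} {f} {g} → graph-∘ f g
    }

  nameF : Functor Rel (Kleisli powerMonad isMonad)
  nameF = record
    { F₀ = λ X → X
    ; F₁ = name
    ; F-resp-≈ = λ {_} {_} {r} {s} → name-resp {r = r} {s}
    ; identity = name-Δ
    ; homomorphism = λ {_} {_} {_} {r} {s} → name-⨾ r s
    }

  kleisli≅Rel : Kleisli powerMonad isMonad ≅ Rel
  kleisli≅Rel = record
    { to = graphF
    ; from = nameF
    -- Both functors are the identity on objects, so with `refl` the transports vanish and the
    -- pointwise inverse laws suffice.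
    ; from∘to = record { eq₀ = λ _ → refl ; eq₁ = name∘graph }
    ; to∘from = record { eq₀ = λ _ → refl ; eq₁ = graph∘name }
    }

theorem3p3 : ∀ {o ℓ e} (𝒯 : Topos o ℓ e) →
    let open ToposProperties 𝒯 in
    Σ[ isCommutative ∈ IsCommutativeMonad powerMonad ]
    (Kleisli powerMonad (IsCommutativeMonad.isMonad isCommutative) ≅ Rel)
theorem3p3 𝒯 = powerCommutative 𝒯 , kleisli≅Rel 𝒯
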